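{- Let $\Gamma$ be a finite group with a nontrivial partition. Then there is a rank-$2$ lift $M$ of the cycle matroid $M(K_3^{\Gamma})$ such that a cycle of $K_3^{\Gamma}$ is a circuit of $M$ if and only if it is balanced.
   Context: For a finite group $\Gamma$ with identity $\epsilon$, $K_3^{\Gamma}$ is the graph with vertex set $\{1,2,3\}$ and edge set $\binom{\{1,2,3\}}{2}\times\Gamma$; the edge $(\{i,j\},\alpha)$ with $i<j$ is oriented from $i$ to $j$ and labeled $\alpha$. A cycle (including a $2$-edge cycle of two parallel edges) is balanced if, traversing it cyclically and multiplying the labels, using $\alpha$ for an edge traversed along its orientation and $\alpha^{ -1}$ for one traversed against it, the product is $\epsilon$. $M(K_3^\Gamma)$ is the cycle matroid of $K_3^\Gamma$. Given matroids $M, L$ on a common ground set $E$, $L$ is a lift of $M$ if there is a matroid $K$ on $E\cup F$ with $M=K/F$ and $L=K\setminus F$; it is a rank-$k$ lift if the rank of $L$ exceeds that of $M$ by $k$. A nontrivial partition of $\Gamma$ is a partition of $\Gamma\setminus\{\epsilon\}$ into at least two sets $A_1,\dots,A_k$ such that each $A_i\cup\{\epsilon\}$ is a subgroup of $\Gamma$. -}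

module Defs where

open import Level using (0ℓ)
open import Data.Nat using (ℕ; _+_; _*_; _≤_; _<_)
open import Data.Fin using (Fin; zero; suc; combine)
open import Data.Fin.Subset using (Subset; _∈_; _∉_; _⊆_; _⊂_; _∪_; ⁅_⁆; ∣_∣; Nonempty)
  renaming (⊥ to ∅; ⊤ to full)
open import Data.Vec using (_++_)
open import Data.Product using (Σ; ∃; ∃-syntax; _×_; _,_)
open import Data.Sum using (_⊎_)
open import Relation.Binary.PropositionalEquality using (_≡_; _≢_)
open import Relation.Nullary using (¬_)
open import Algebra.Structures using (IsGroup)
open import Function.Bundles using (_⇔_)

-- Finite groups: a group structure (with propositional equality) on Fin n.
-- Every finite group is isomorphic to one of this form.

record FinGroup : Set where
  field
    order   : ℕ
    _∙_     : Fin order → Fin order → Fin order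
    ε       : Fin order
    _⁻¹     : Fin order → Fin order
    isGroup : IsGroup _≡_ _∙_ ε _⁻¹

module _ (Γ : FinGroup) where
  open FinGroup Γ

  IsSubgroup : Subset order → Set
  IsSubgroup S = (ε ∈ S)
               × (∀ x y → x ∈ S → y ∈ S → (x ∙ y) ∈ S)
               × (∀ x → x ∈ S → (x ⁻¹) ∈ S)

  NontrivialPartition : Set
  NontrivialPartition =
    Σ ℕ λ k → Σ (Fin k → Subset order) λ A →
        (2 ≤ k)
      × (∀ i → Nonempty (A i))
      × (∀ i → ε ∉ A i)
      × (∀ g → g ≢ ε → ∃[ i ] (g ∈ A i))
      × (∀ g i j → g ∈ A i → g ∈ A j → i ≡ j)
      × (∀ i → IsSubgroup (A i ∪ ⁅ ε ⁆))

record Matroid (m : ℕ) : Set₁ where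
  field
    Indep     : Subset m → Set
    indep-∅   : Indep ∅
    indep-⊆   : ∀ {X Y} → X ⊆ Y → Indep Y → Indep X
    indep-aug : ∀ {X Y} → Indep X → Indep Y → ∣ X ∣ < ∣ Y ∣ →
                ∃[ y ] (y ∈ Y × y ∉ X × Indep (X ∪ ⁅ y ⁆))
open Matroid public

HasRank : ∀ {m} → (Subset m → Set) → ℕ → Set
HasRank {m} I r = (∃[ X ] (I X × ∣ X ∣ ≡ r)) × (∀ X → I X → ∣ X ∣ ≤ r)

-- Ground set E ∪ F of K is Fin (m + f): E = first m elements, F = last f.
embedE : ∀ {m f} → Subset m → Subset (m + f)
embedE {m} {f} X = X ++ ∅ {f}

Fset : ∀ m f → Subset (m + f)
Fset m f = ∅ {m} ++ full {f}

DeleteIndep : ∀ {m f} → Matroid (m + f) → Subset m → Set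
DeleteIndep {m} {f} K X = Indep K (embedE {m} {f} X)

ContractIndep : ∀ {m f} → Matroid (m + f) → Subset m → Set
ContractIndep {m} {f} K X =
  ∃[ B ] ( B ⊆ Fset m f
         × Indep K B
         × (∀ y → y ∈ Fset m f → y ∉ B → ¬ Indep K (B ∪ ⁅ y ⁆))
         × Indep K (embedE {m} {f} X ∪ B))

IsLift : ∀ {m} → (Subset m → Set) → Matroid m → Set₁
IsLift {m} IM L =
  Σ ℕ λ f → Σ (Matroid (m + f)) λ K →
      (∀ X → IM X ⇔ ContractIndep {m} {f} K X)
    × (∀ X → Indep L X ⇔ DeleteIndep {m} {f} K X)

IsRankLift : ∀ {m} → ℕ → (Subset m → Set) → Matroid m → Set₁
IsRankLift k IM L = IsLift IM L × ∃[ r ] (HasRank IM r × HasRank (Indep L) (r + k))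

IsCircuit : ∀ {m} → Matroid m → Subset m → Set
IsCircuit M C = ¬ Indep M C × (∀ Y → Y ⊂ C → Indep M Y)

-- The graph K₃^Γ.  Vertex pairs are coded by Fin 3:
--   zero ↦ {1,2},  suc zero ↦ {2,3},  suc (suc zero) ↦ {1,3},
-- and the edge ({i,j}, α) (oriented i → j, i < j) is  edge p α,
-- an element of the ground set Fin (3 * |Γ|).

module _ (Γ : FinGroup) where
  open FinGroup Γ

  Edges : ℕ
  Edges = 3 * order

  edge : Fin 3 → Fin order → Fin Edges
  edge p α = combine p α

  p12 p23 p13 : Fin 3
  p12 = zero
  p23 = suc zero
  p13 = suc (suc zero)

  data Cycle : Set where
    digon    : (p : Fin 3) (α β : Fin order) → α ≢ β → Cycle
    triangle : (α β γ : Fin order) → Cycle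

  cycleEdges : Cycle → Subset Edges
  cycleEdges (digon p α β _)  = ⁅ edge p α ⁆ ∪ ⁅ edge p β ⁆
  cycleEdges (triangle α β γ) = (⁅ edge p12 α ⁆ ∪ ⁅ edge p23 β ⁆) ∪ ⁅ edge p13 γ ⁆

  -- balance: product of labels around the cycle
  --   digon on {i,j}: i →α j, then j → i against β : α β⁻¹
  --   triangle: 1 →α 2 →β 3, then 3 → 1 against γ : α β γ⁻¹
  Balanced : Cycle → Set
  Balanced (digon p α β _)  = (α ∙ (β ⁻¹)) ≡ ε
  Balanced (triangle α β γ) = ((α ∙ β) ∙ (γ ⁻¹)) ≡ ε

  CycleIndep : Subset Edges → Set
  CycleIndep X = ¬ (∃[ c ] (cycleEdges c ⊆ X))

module Submission where

-- Intersecting all conjugates of the parts refines the given partition to one whose cells are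
-- permuted by conjugation; these cells are the "directions" of Γ.  Call (t₁ , t₂ , t₃) ∈ Γ³ a frame;
-- relative to it, the edge α from i to j has gain tᵢ⁻¹ α tⱼ.  The lift has rank 4, so it is given by
-- its lines and planes.  The lines are the balanced triangles (all gains trivial in some frame) and,
-- within one class of parallel edges, the cosets of the directions; the planes are the three classes,
-- and the sets of edges whose gain lies in a given direction relative to a given frame.  Any three
-- noncollinear edges lie in exactly one plane because a plane through two edges of different classes
-- can be rewritten in a frame depending only on these two edges.  The contracted set consists of two
-- generic points f added on the common intersection of the three class planes: each f spans a plane
-- with every balanced triangle, and contracting both makes each class a parallel class.

open import Defs
open import Level using (0ℓ)
open import Algebra.Bundles using (Group)
import Algebra.Properties.Group as GroupProperties
open import Data.Bool using (Bool; true; false; not)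
open import Data.Empty using (⊥-elim)
open import Data.Fin using (Fin; zero; suc; _↑ˡ_; _↑ʳ_; splitAt; join; remQuot; fromℕ<)
open import Data.Fin.Properties using (_≟_; any?; all?; fromℕ<-injective; splitAt-↑ˡ; splitAt-↑ʳ; join-splitAt; remQuot-combine; combine-remQuot; combine-injective; ↑ˡ-injective)
open import Data.Fin.Subset using (Subset; inside; outside; _∈_; _∉_; _⊆_; _∩_; _∪_; ⁅_⁆; ∣_∣) renaming (⊥ to ∅)
open import Data.Fin.Subset.Properties
open import Data.List using (List; []; _∷_; length; map)
open import Data.List.Relation.Unary.All as All using (All; []; _∷_)
open import Data.List.Relation.Unary.AllPairs as AllPairs using ([]; _∷_)
open import Data.List.Relation.Unary.Unique.Propositional using (Unique)
open import Data.List.Relation.Unary.Unique.Propositional.Properties using (map⁺)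
open import Data.Nat using (ℕ; zero; suc; _+_; _≤_; _<_; _≰_; z≤n; s≤s; s≤s⁻¹)
open import Data.Nat.Properties using (≤-trans; ≤-reflexive; m≤n⇒m≤1+n; ≰⇒>; <⇒≱; ≤-<-trans; <⇒≤; 1+n≰n)
open import Data.Product using (Σ; ∃-syntax; _×_; _,_; proj₁; proj₂; uncurry)
open import Data.Sum as Sum using (_⊎_; inj₁; inj₂; [_,_])
open import Data.Vec using (Vec; []; _∷_; here; there; tabulate; lookup)
open import Data.Vec.Properties using (lookup∘tabulate; []=⇒lookup; lookup⇒[]=)
open import Function using (_∘_; id)
open import Function.Bundles using (_⇔_; mk⇔)
open import Relation.Binary.PropositionalEquality using (_≡_; _≢_; refl; sym; trans; cong; cong₂; subst; subst₂)
import Relation.Binary.Reflection as Reflection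
open import Relation.Nullary using (¬_; Dec; yes; no; contradiction; ¬?; does; _×-dec_; _→-dec_)
open import Relation.Nullary.Decidable using (dec-true; map′)
open import Relation.Unary using (Pred; Decidable)

-- Finite subsets: cardinalities, duplicate-free lists and comprehension.

⁅x⁆⊆p : ∀ {m} {p : Subset m} {x} → x ∈ p → ⁅ x ⁆ ⊆ p
⁅x⁆⊆p {p = p} {x} x∈p y∈ = subst (_∈ p) (sym (x∈⁅y⁆⇒x≡y x y∈)) x∈p

∪-least : ∀ {m} {p q r : Subset m} → p ⊆ r → q ⊆ r → p ∪ q ⊆ r
∪-least {p = p} {q} p⊆r q⊆r x∈ = [ p⊆r , q⊆r ] (x∈p∪q⁻ p q x∈)

∣p∪⁅x⁆∣ : ∀ {m} (p : Subset m) {x} → x ∉ p → ∣ p ∪ ⁅ x ⁆ ∣ ≡ suc ∣ p ∣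
∣p∪⁅x⁆∣ (inside  ∷ p) {zero}  x∉p = contradiction here x∉p
∣p∪⁅x⁆∣ (outside ∷ p) {zero}  x∉p = cong (suc ∘ ∣_∣) (∪-identityʳ p)
∣p∪⁅x⁆∣ (inside  ∷ p) {suc x} x∉p = cong suc (∣p∪⁅x⁆∣ p (x∉p ∘ there))
∣p∪⁅x⁆∣ (outside ∷ p) {suc x} x∉p = ∣p∪⁅x⁆∣ p (x∉p ∘ there)

∣p∪⁅x⁆∣≤ : ∀ {m} (p : Subset m) x → ∣ p ∪ ⁅ x ⁆ ∣ ≤ suc ∣ p ∣
∣p∪⁅x⁆∣≤ p x with x ∈? p
... | no  x∉p = ≤-reflexive (∣p∪⁅x⁆∣ p x∉p)
... | yes x∈p = m≤n⇒m≤1+n (p⊆q⇒∣p∣≤∣q∣ (∪-least ⊆-refl (⁅x⁆⊆p x∈p)))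

∈-outside : ∀ {m} (p q : Subset m) → ∣ p ∩ q ∣ < ∣ p ∣ → ∃[ x ] (x ∈ p × x ∉ q)
∈-outside p q lt with any? (λ x → (x ∈? p) ×-dec ¬? (x ∈? q))
... | yes found = found
... | no none = contradiction (p⊆q⇒∣p∣≤∣q∣ p⊆p∩q) (<⇒≱ lt)
  where
  p⊆p∩q : p ⊆ p ∩ q
  p⊆p∩q {x} x∈p with x ∈? q
  ... | yes x∈q = x∈p∩q⁺ (x∈p , x∈q)
  ... | no  x∉q = contradiction (x , x∈p , x∉q) none

-- The head is adjoined on the right, so that the set of `x ∷ xs` is literally of the form that an
-- augmentation step produces.
fromList : ∀ {m} → List (Fin m) → Subset m
fromList []       = ∅
fromList (x ∷ xs) = fromList xs ∪ ⁅ x ⁆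

All-∈⇒⊆ : ∀ {m} {p : Subset m} {xs} → All (_∈ p) xs → fromList xs ⊆ p
All-∈⇒⊆ []           x∈ = contradiction x∈ ∉⊥
All-∈⇒⊆ (y∈p ∷ ys∈p) x∈ = ∪-least (All-∈⇒⊆ ys∈p) (⁅x⁆⊆p y∈p) x∈

∉-fromList : ∀ {m} {x : Fin m} {xs} → All (x ≢_) xs → x ∉ fromList xs
∉-fromList [] x∈ = ∉⊥ x∈
∉-fromList {xs = y ∷ ys} (x≢y ∷ x≢ys) x∈ with x∈p∪q⁻ (fromList ys) ⁅ y ⁆ x∈
... | inj₁ x∈ys = ∉-fromList x≢ys x∈ys
... | inj₂ x∈⁅y⁆ = x≢y (x∈⁅y⁆⇒x≡y y x∈⁅y⁆)

∉-fromList⁻ : ∀ {m} {x : Fin m} xs → x ∉ fromList xs → All (x ≢_) xs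
∉-fromList⁻ []       x∉ = []
∉-fromList⁻ (y ∷ ys) x∉ = (λ { refl → x∉ (q⊆p∪q (fromList ys) ⁅ y ⁆ (x∈⁅x⁆ y)) }) ∷ ∉-fromList⁻ ys (x∉ ∘ p⊆p∪q ⁅ y ⁆)

∣fromList∣ : ∀ {m} {xs : List (Fin m)} → Unique xs → ∣ fromList xs ∣ ≡ length xs
∣fromList∣ {m} []          = ∣⊥∣≡0 m
∣fromList∣ {xs = x ∷ xs} (x≢xs ∷ u) = trans (∣p∪⁅x⁆∣ (fromList xs) (∉-fromList x≢xs)) (cong suc (∣fromList∣ u))

-- Used to refute the bounds of an independent set by exhibiting too many distinct elements.
length≤∣p∣ : ∀ {m} {p : Subset m} {xs} → Unique xs → All (_∈ p) xs → length xs ≤ ∣ p ∣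
length≤∣p∣ u xs∈p = ≤-trans (≤-reflexive (sym (∣fromList∣ u))) (p⊆q⇒∣p∣≤∣q∣ (All-∈⇒⊆ xs∈p))

new-element : ∀ {m} (p : Subset m) {xs} → Unique xs → All (_∈ p) xs → length xs < ∣ p ∣ →
  ∃[ x ] (Unique (x ∷ xs) × All (_∈ p) (x ∷ xs))
new-element p {xs} u xs∈p lt =
  let x , x∈p , x∉xs = ∈-outside p (fromList xs)
        (≤-<-trans (≤-trans (∣p∩q∣≤∣q∣ p (fromList xs)) (≤-reflexive (∣fromList∣ u))) lt)
  in x , ∉-fromList⁻ xs x∉xs ∷ u , x∈p ∷ xs∈p

two-elements : ∀ {m} (p : Subset m) → 2 ≤ ∣ p ∣ →
  ∃[ a ] ∃[ b ] (a ≢ b × a ∈ p × b ∈ p)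
two-elements p 2≤ =
  let b , u₁ , b∈p  = new-element p [] [] (<⇒≤ 2≤)
      a , u₂ , ab∈p = new-element p u₁ b∈p 2≤
  in a , b , All.head (AllPairs.head u₂) , All.head ab∈p , All.head b∈p

three-elements : ∀ {m} (p : Subset m) → 3 ≤ ∣ p ∣ →
  ∃[ a ] ∃[ b ] ∃[ c ] (a ≢ b × Unique (a ∷ b ∷ c ∷ []) × a ∈ p × b ∈ p × c ∈ p)
three-elements p 3≤ =
  let b , c , b≢c , b∈p , c∈p = two-elements p (<⇒≤ 3≤)
      a , u , abc∈p           = new-element p ((b≢c ∷ []) ∷ [] ∷ []) (b∈p ∷ c∈p ∷ []) 3≤
  in a , b , c , All.head (AllPairs.head u) , u , All.head abc∈p , b∈p , c∈p

-- An element outside the list could be added to it and would make a duplicate-free list longer than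
-- `∣ p ∣`.
fromList-full : ∀ {m} (p : Subset m) {xs} → Unique xs → All (_∈ p) xs → length xs ≡ ∣ p ∣ → p ⊆ fromList xs
fromList-full p {xs} u xs∈p len {x} x∈p with x ∈? fromList xs
... | yes x∈xs = x∈xs
... | no  x∉xs = contradiction (≤-trans (length≤∣p∣ (∉-fromList⁻ xs x∉xs ∷ u) (x∈p ∷ xs∈p)) (≤-reflexive (sym len))) 1+n≰n

∣fromList∣≤ : ∀ {m} (xs : List (Fin m)) → ∣ fromList xs ∣ ≤ length xs
∣fromList∣≤ {m} []   = ≤-reflexive (∣⊥∣≡0 m)
∣fromList∣≤ (x ∷ xs) = ≤-trans (∣p∪⁅x⁆∣≤ (fromList xs) x) (s≤s (∣fromList∣≤ xs))

module _ {m} {P : Pred (Fin m) 0ℓ} (P? : Decidable P) where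

  comprehension : Subset m
  comprehension = tabulate (does ∘ P?)

  ∈-comprehension⁺ : ∀ {x} → P x → x ∈ comprehension
  ∈-comprehension⁺ {x} px = lookup⇒[]= x _ (trans (lookup∘tabulate _ x) (dec-true (P? x) px))

  ∈-comprehension⁻ : ∀ {x} → x ∈ comprehension → P x
  ∈-comprehension⁻ {x} x∈ with P? x | trans (sym (lookup∘tabulate (does ∘ P?) x)) ([]=⇒lookup x∈)
  ... | yes px | _ = px
  ... | no _   | ()

-- Rank-4 matroids from systems of lines and planes.

record PlanarSpace (m : ℕ) : Set₁ where
  field
    Line Plane    : Set
    line          : Line → Subset m
    plane         : Plane → Subset m
    line-through  : ∀ {a b} → a ≢ b → ∃[ ℓ ] (a ∈ line ℓ × b ∈ line ℓ)
    -- Uniqueness is stated as an inclusion; exchanging the roles gives equality as sets. One set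
    -- may thus have several indices, as when different frames describe the same triangle.
    line-unique   : ∀ {a b} ℓ ℓ′ → a ≢ b → a ∈ line ℓ → b ∈ line ℓ →
                    a ∈ line ℓ′ → b ∈ line ℓ′ → line ℓ ⊆ line ℓ′
    plane-through : ∀ ℓ c → ∃[ π ] (line ℓ ⊆ plane π × c ∈ plane π)
    line⊆plane    : ∀ {a b} ℓ π → a ≢ b → a ∈ line ℓ → b ∈ line ℓ →
                    a ∈ plane π → b ∈ plane π → line ℓ ⊆ plane π
    plane-unique  : ∀ {a b c} π π′ → (∀ ℓ → ¬ (a ∈ line ℓ × b ∈ line ℓ × c ∈ line ℓ)) →
                    a ∈ plane π → b ∈ plane π → c ∈ plane π →
                    a ∈ plane π′ → b ∈ plane π′ → c ∈ plane π′ → plane π ⊆ plane π′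

module PlanarMatroid {m : ℕ} (S : PlanarSpace m) where
  open PlanarSpace S

  record Independent (X : Subset m) : Set where
    constructor independent
    field
      ∣X∣≤4       : ∣ X ∣ ≤ 4
      ∣X∩line∣≤2  : ∀ ℓ → ∣ X ∩ line ℓ ∣ ≤ 2
      ∣X∩plane∣≤3 : ∀ π → ∣ X ∩ plane π ∣ ≤ 3
  open Independent public

  independent-⊆ : ∀ {X Y} → X ⊆ Y → Independent Y → Independent X
  independent-⊆ {X} {Y} X⊆Y (independent c l p) = independent
    (≤-trans (p⊆q⇒∣p∣≤∣q∣ X⊆Y) c)
    (λ ℓ → ≤-trans (∩-mono (line ℓ)) (l ℓ))
    (λ π → ≤-trans (∩-mono (plane π)) (p π))
    where
    ∩-mono : ∀ Z → ∣ X ∩ Z ∣ ≤ ∣ Y ∩ Z ∣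
    ∩-mono Z = p⊆q⇒∣p∣≤∣q∣ λ x∈ → let x∈X , x∈Z = x∈p∩q⁻ X Z x∈ in x∈p∩q⁺ (X⊆Y x∈X , x∈Z)

  ∣X∣≤2⇒independent : ∀ {X} → ∣ X ∣ ≤ 2 → Independent X
  ∣X∣≤2⇒independent {X} c = independent
    (≤-trans c (s≤s (s≤s z≤n)))
    (λ ℓ → ≤-trans (∣p∩q∣≤∣p∣ X (line ℓ)) c)
    (λ π → ≤-trans (∣p∩q∣≤∣p∣ X (plane π)) (m≤n⇒m≤1+n c))

  -- The trace on `Z` grows only if `y` lies in `Z`, so strictness is demanded only in that case.
  ∣∪⁅y⁆∩∣≤ : ∀ (X : Subset m) {y n} Z → ∣ X ∩ Z ∣ ≤ n → (y ∈ Z → ∣ X ∩ Z ∣ < n) → ∣ (X ∪ ⁅ y ⁆) ∩ Z ∣ ≤ n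
  ∣∪⁅y⁆∩∣≤ X {y} Z bound strict with y ∈? Z
  ... | yes y∈Z = ≤-trans (p⊆q⇒∣p∣≤∣q∣ sub) (≤-trans (∣p∪⁅x⁆∣≤ (X ∩ Z) y) (strict y∈Z))
    where
    sub : (X ∪ ⁅ y ⁆) ∩ Z ⊆ (X ∩ Z) ∪ ⁅ y ⁆
    sub x∈ with x∈p∩q⁻ (X ∪ ⁅ y ⁆) Z x∈
    ... | x∈Xy , x∈Z with x∈p∪q⁻ X ⁅ y ⁆ x∈Xy
    ... | inj₁ x∈X = x∈p∪q⁺ (inj₁ (x∈p∩q⁺ (x∈X , x∈Z)))
    ... | inj₂ x∈y = x∈p∪q⁺ (inj₂ x∈y)
  ... | no y∉Z = ≤-trans (p⊆q⇒∣p∣≤∣q∣ sub) bound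
    where
    sub : (X ∪ ⁅ y ⁆) ∩ Z ⊆ X ∩ Z
    sub x∈ with x∈p∩q⁻ (X ∪ ⁅ y ⁆) Z x∈
    ... | x∈Xy , x∈Z with x∈p∪q⁻ X ⁅ y ⁆ x∈Xy
    ... | inj₁ x∈X = x∈p∩q⁺ (x∈X , x∈Z)
    ... | inj₂ x∈y = contradiction (subst (_∈ Z) (x∈⁅y⁆⇒x≡y y x∈y) x∈Z) y∉Z

  -- A line through `y` with two elements of `X` shares these with `ℓ`, hence is contained in `ℓ`,
  -- which misses `y`.
  extend-line : ∀ {X y} ℓ → ∣ X ∣ ≡ 2 → X ⊆ line ℓ → y ∉ line ℓ → Independent (X ∪ ⁅ y ⁆)
  extend-line {X} {y} ℓ ∣X∣≡2 X⊆ℓ y∉ℓ = independent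
    (m≤n⇒m≤1+n size)
    (λ ℓ′ → ∣∪⁅y⁆∩∣≤ X (line ℓ′) (≤-trans (∣p∩q∣≤∣p∣ X (line ℓ′)) (≤-reflexive ∣X∣≡2)) (λ y∈ℓ′ → ≰⇒> (meet ℓ′ y∈ℓ′)))
    (λ π → ≤-trans (∣p∩q∣≤∣p∣ (X ∪ ⁅ y ⁆) (plane π)) size)
    where
    size : ∣ X ∪ ⁅ y ⁆ ∣ ≤ 3
    size = ≤-trans (∣p∪⁅x⁆∣≤ X y) (s≤s (≤-reflexive ∣X∣≡2))
    meet : ∀ ℓ′ → y ∈ line ℓ′ → 2 ≰ ∣ X ∩ line ℓ′ ∣
    meet ℓ′ y∈ℓ′ two =
      let a , b , a≢b , a∈ , b∈ = two-elements (X ∩ line ℓ′) two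
          a∈X , a∈ℓ′ = x∈p∩q⁻ X (line ℓ′) a∈
          b∈X , b∈ℓ′ = x∈p∩q⁻ X (line ℓ′) b∈
      in y∉ℓ (line-unique ℓ′ ℓ a≢b a∈ℓ′ b∈ℓ′ (X⊆ℓ a∈X) (X⊆ℓ b∈X) y∈ℓ′)

  -- A line through `y` with two elements of `X` would lie in `π`. A plane through `y` with three
  -- elements of `X` would too, since independence of `X` makes these three noncollinear.
  extend-plane : ∀ {X y} π → Independent X → ∣ X ∣ ≡ 3 → X ⊆ plane π → y ∉ plane π → Independent (X ∪ ⁅ y ⁆)
  extend-plane {X} {y} π iX ∣X∣≡3 X⊆π y∉π = independent
    (≤-trans (∣p∪⁅x⁆∣≤ X y) (s≤s (≤-reflexive ∣X∣≡3)))
    (λ ℓ → ∣∪⁅y⁆∩∣≤ X (line ℓ) (∣X∩line∣≤2 iX ℓ) (λ y∈ℓ → ≰⇒> (meet-line ℓ y∈ℓ)))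
    (λ π′ → ∣∪⁅y⁆∩∣≤ X (plane π′) (≤-trans (∣p∩q∣≤∣p∣ X (plane π′)) (≤-reflexive ∣X∣≡3)) (λ y∈π′ → ≰⇒> (meet-plane π′ y∈π′)))
    where
    meet-line : ∀ ℓ → y ∈ line ℓ → 2 ≰ ∣ X ∩ line ℓ ∣
    meet-line ℓ y∈ℓ two =
      let a , b , a≢b , a∈ , b∈ = two-elements (X ∩ line ℓ) two
          a∈X , a∈ℓ = x∈p∩q⁻ X (line ℓ) a∈
          b∈X , b∈ℓ = x∈p∩q⁻ X (line ℓ) b∈
      in y∉π (line⊆plane ℓ π a≢b a∈ℓ b∈ℓ (X⊆π a∈X) (X⊆π b∈X) y∈ℓ)
    meet-plane : ∀ π′ → y ∈ plane π′ → 3 ≰ ∣ X ∩ plane π′ ∣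
    meet-plane π′ y∈π′ three =
      let a , b , c , _ , u , a∈ , b∈ , c∈ = three-elements (X ∩ plane π′) three
          a∈X , a∈π′ = x∈p∩q⁻ X (plane π′) a∈
          b∈X , b∈π′ = x∈p∩q⁻ X (plane π′) b∈
          c∈X , c∈π′ = x∈p∩q⁻ X (plane π′) c∈
          noncollinear : ∀ ℓ → ¬ (a ∈ line ℓ × b ∈ line ℓ × c ∈ line ℓ)
          noncollinear ℓ (a∈ℓ , b∈ℓ , c∈ℓ) = 1+n≰n (≤-trans
            (length≤∣p∣ u (x∈p∩q⁺ (a∈X , a∈ℓ) ∷ x∈p∩q⁺ (b∈X , b∈ℓ) ∷ x∈p∩q⁺ (c∈X , c∈ℓ) ∷ []))
                (∣X∩line∣≤2 iX ℓ))
      in y∉π (plane-unique π′ π noncollinear a∈π′ b∈π′ c∈π′ (X⊆π a∈X) (X⊆π b∈X) (X⊆π c∈X) y∈π′)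

  ∣X∣≡2⇒⊆line : ∀ {X} → ∣ X ∣ ≡ 2 → ∃[ ℓ ] (X ⊆ line ℓ)
  ∣X∣≡2⇒⊆line {X} eq =
    let a , b , a≢b , a∈X , b∈X = two-elements X (≤-reflexive (sym eq))
        ℓ , a∈ℓ , b∈ℓ = line-through a≢b
    in ℓ , All-∈⇒⊆ (a∈ℓ ∷ b∈ℓ ∷ []) ∘ fromList-full X ((a≢b ∷ []) ∷ [] ∷ []) (a∈X ∷ b∈X ∷ []) (sym eq)

  ∣X∣≡3⇒⊆plane : ∀ {X} → ∣ X ∣ ≡ 3 → ∃[ π ] (X ⊆ plane π)
  ∣X∣≡3⇒⊆plane {X} eq =
    let a , b , c , a≢b , u , a∈X , b∈X , c∈X = three-elements X (≤-reflexive (sym eq))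
        ℓ , a∈ℓ , b∈ℓ = line-through a≢b
        π , ℓ⊆π , c∈π = plane-through ℓ c
    in π , All-∈⇒⊆ (ℓ⊆π a∈ℓ ∷ ℓ⊆π b∈ℓ ∷ c∈π ∷ []) ∘ fromList-full X u (a∈X ∷ b∈X ∷ c∈X ∷ []) (sym eq)

  -- A set `X` of size 2 spans a line and one of size 3 a plane; such a flat contains at most 2 or 3
  -- elements of `Y`, so the larger set `Y` has an element outside it.
  augment : ∀ {X Y} → Independent X → Independent Y → ∣ X ∣ < ∣ Y ∣ →
            ∃[ y ] (y ∈ Y × y ∉ X × Independent (X ∪ ⁅ y ⁆))
  augment {X} {Y} iX (independent cY lY pY) lt = go ∣ X ∣ refl
    where
    small : ∣ X ∣ ≤ 1 → ∃[ y ] (y ∈ Y × y ∉ X × Independent (X ∪ ⁅ y ⁆))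
    small ≤1 =
      let y , y∈Y , y∉X = ∈-outside Y X (≤-<-trans (∣p∩q∣≤∣q∣ Y X) lt)
      in y , y∈Y , y∉X , ∣X∣≤2⇒independent (≤-trans (∣p∪⁅x⁆∣≤ X y) (s≤s ≤1))
    go : ∀ n → ∣ X ∣ ≡ n → ∃[ y ] (y ∈ Y × y ∉ X × Independent (X ∪ ⁅ y ⁆))
    go 0 eq = small (≤-trans (≤-reflexive eq) z≤n)
    go 1 eq = small (≤-reflexive eq)
    go 2 eq =
      let ℓ , X⊆ℓ = ∣X∣≡2⇒⊆line eq
          y , y∈Y , y∉ℓ = ∈-outside Y (line ℓ) (≤-trans (s≤s (lY ℓ)) (subst (_< ∣ Y ∣) eq lt))
      in y , y∈Y , y∉ℓ ∘ X⊆ℓ , extend-line ℓ eq X⊆ℓ y∉ℓ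
    go 3 eq =
      let π , X⊆π = ∣X∣≡3⇒⊆plane eq
          y , y∈Y , y∉π = ∈-outside Y (plane π) (≤-trans (s≤s (pY π)) (subst (_< ∣ Y ∣) eq lt))
      in y , y∈Y , y∉π ∘ X⊆π , extend-plane π iX eq X⊆π y∉π
    -- Here `Y` would have at least five elements, against its bound of four.
    go (suc (suc (suc (suc n)))) eq =
      contradiction (≤-trans (subst (_< ∣ Y ∣) eq lt) cY) (<⇒≱ (s≤s (s≤s (s≤s (s≤s (s≤s z≤n))))))

  matroid : Matroid m
  matroid = record
    { Indep     = Independent
    ; indep-∅   = ∣X∣≤2⇒independent (≤-trans (≤-reflexive (∣⊥∣≡0 m)) z≤n)
    ; indep-⊆   = independent-⊆
    ; indep-aug = augment
    }

-- Subsets of E and F inside E ∪ F, and deletion of F.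

∈-embedE⁺ : ∀ {m} f {X : Subset m} {x} → x ∈ X → x ↑ˡ f ∈ embedE X
∈-embedE⁺ f here       = here
∈-embedE⁺ f (there x∈) = there (∈-embedE⁺ f x∈)

∈-embedE⁻ : ∀ {m} f (X : Subset m) {i} → i ∈ embedE {f = f} X → ∃[ x ] (x ∈ X × i ≡ x ↑ˡ f)
∈-embedE⁻ f []      i∈   = contradiction i∈ ∉⊥
∈-embedE⁻ f (_ ∷ X) here = zero , here , refl
∈-embedE⁻ f (_ ∷ X) (there i∈) = let x , x∈ , eq = ∈-embedE⁻ f X i∈ in suc x , there x∈ , cong suc eq

∣embedE∣ : ∀ {m} f (X : Subset m) → ∣ embedE {f = f} X ∣ ≡ ∣ X ∣
∣embedE∣ f []            = ∣⊥∣≡0 f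
∣embedE∣ f (inside  ∷ X) = cong suc (∣embedE∣ f X)
∣embedE∣ f (outside ∷ X) = ∣embedE∣ f X

embedE-mono : ∀ {m} f {X Y : Subset m} → X ⊆ Y → embedE {f = f} X ⊆ embedE Y
embedE-mono f {X} X⊆Y i∈ with ∈-embedE⁻ f X i∈
... | x , x∈X , refl = ∈-embedE⁺ f (X⊆Y x∈X)

embedE-⁅⁆ : ∀ {m} f (x : Fin m) → embedE {f = f} ⁅ x ⁆ ⊆ ⁅ x ↑ˡ f ⁆
embedE-⁅⁆ f x i∈ with ∈-embedE⁻ f ⁅ x ⁆ i∈
... | y , y∈x , refl rewrite x∈⁅y⁆⇒x≡y x y∈x = x∈⁅x⁆ _

embedE-∪⁅⁆ : ∀ {m} f (X : Subset m) x → embedE {f = f} (X ∪ ⁅ x ⁆) ⊆ embedE X ∪ ⁅ x ↑ˡ f ⁆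
embedE-∪⁅⁆ f X x i∈ with ∈-embedE⁻ f (X ∪ ⁅ x ⁆) i∈
... | y , y∈ , refl = [ (λ y∈X → p⊆p∪q _ (∈-embedE⁺ f y∈X)) , (λ y∈x → q⊆p∪q (embedE X) _ (embedE-⁅⁆ f x (∈-embedE⁺ f y∈x))) ]
  (x∈p∪q⁻ X ⁅ x ⁆ y∈)

embedE-fromList : ∀ {m} f (xs : List (Fin m)) → embedE {f = f} (fromList xs) ⊆ fromList (map (_↑ˡ f) xs)
embedE-fromList f [] i∈ = let _ , x∈ , _ = ∈-embedE⁻ f ∅ i∈ in contradiction x∈ ∉⊥
embedE-fromList f (x ∷ xs) i∈ = ∪-least
  (λ i∈xs → p⊆p∪q _ (embedE-fromList f xs i∈xs)) (q⊆p∪q (fromList (map (_↑ˡ f) xs)) _)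
  (embedE-∪⁅⁆ f (fromList xs) x i∈)

∈-Fset⁺ : ∀ m {f} (k : Fin f) → m ↑ʳ k ∈ Fset m f
∈-Fset⁺ zero    k = ∈⊤
∈-Fset⁺ (suc m) k = there (∈-Fset⁺ m k)

∈-Fset⁻ : ∀ m {f} {i} → i ∈ Fset m f → ∃[ k ] (i ≡ m ↑ʳ k)
∈-Fset⁻ zero    {i = i} _  = i , refl
∈-Fset⁻ (suc m) (there i∈) = let k , eq = ∈-Fset⁻ m i∈ in k , cong suc eq

∣Fset∣ : ∀ m f → ∣ Fset m f ∣ ≡ f
∣Fset∣ zero    f = ∣⊤∣≡n f
∣Fset∣ (suc m) f = ∣Fset∣ m f

-- Its independence is `DeleteIndep` by definition, so the deletion half of being a lift becomes the
-- identity.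
restriction : ∀ {m} f → Matroid (m + f) → Matroid m
restriction {m} f K = record
  { Indep     = DeleteIndep {m} {f} K
  ; indep-∅   = indep-⊆ K (λ i∈ → let x , x∈ , _ = ∈-embedE⁻ f ∅ i∈ in contradiction x∈ ∉⊥) (indep-∅ K)
  ; indep-⊆   = λ X⊆Y → indep-⊆ K (embedE-mono f X⊆Y)
  ; indep-aug = aug
  }
  where
  aug : ∀ {X Y} → DeleteIndep {m} {f} K X → DeleteIndep {m} {f} K Y → ∣ X ∣ < ∣ Y ∣ →
        ∃[ y ] (y ∈ Y × y ∉ X × DeleteIndep {m} {f} K (X ∪ ⁅ y ⁆))
  aug {X} {Y} iX iY lt
    with indep-aug K iX iY (subst₂ _<_ (sym (∣embedE∣ f X)) (sym (∣embedE∣ f Y)) lt)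
  ... | i , i∈ , i∉ , ind with ∈-embedE⁻ f Y i∈
  ... | y , y∈Y , refl = y , y∈Y , i∉ ∘ ∈-embedE⁺ f , indep-⊆ K (embedE-∪⁅⁆ f X y) ind

-- A solver for identities valid in all groups, by free reduction.

module GroupSolver (G : Group 0ℓ 0ℓ) where
  open Group G renaming (refl to ≈-refl; sym to ≈-sym; trans to ≈-trans)
  open GroupProperties G

  infixl 7 _⊙_
  infix  8 _⁻

  data Expr (n : ℕ) : Set where
    var : Fin n → Expr n
    _⊙_ : Expr n → Expr n → Expr n
    𝟙   : Expr n
    _⁻  : Expr n → Expr n

  ⟦_⟧ : ∀ {n} → Expr n → Vec Carrier n → Carrier
  ⟦ var i ⟧ ρ = lookup ρ i
  ⟦ a ⊙ b ⟧ ρ = ⟦ a ⟧ ρ ∙ ⟦ b ⟧ ρ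
  ⟦ 𝟙 ⟧ ρ     = ε
  ⟦ a ⁻ ⟧ ρ   = ⟦ a ⟧ ρ ⁻¹

  -- A word of the free group; `true` marks the exponent 1 and `false` the exponent -1.
  Word : ℕ → Set
  Word n = List (Bool × Fin n)

  _^_ : Carrier → Bool → Carrier
  x ^ true  = x
  x ^ false = x ⁻¹

  word : ∀ {n} → Word n → Vec Carrier n → Carrier
  word []            ρ = ε
  word ((s , i) ∷ w) ρ = (lookup ρ i ^ s) ∙ word w ρ

  -- Comparing with the head suffices: a reduced word stays reduced, and normalization starts from
  -- the empty word.
  push : ∀ {n} → Bool → Fin n → Word n → Word n
  push s i [] = (s , i) ∷ []
  push s i ((r , j) ∷ w) with i ≟ j
  push true  i ((false , j) ∷ w) | yes _ = w
  push false i ((true  , j) ∷ w) | yes _ = w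
  push s     i ((r , j) ∷ w)     | _     = (s , i) ∷ (r , j) ∷ w

  -- The word accumulates what stands to the right of the expression, and the Boolean is `false`
  -- below an odd number of inversions; a product is then read backwards.
  reduce : ∀ {n} → Bool → Expr n → Word n → Word n
  reduce s     (var i) w = push s i w
  reduce true  (a ⊙ b) w = reduce true a (reduce true b w)
  reduce false (a ⊙ b) w = reduce false b (reduce false a w)
  reduce s     𝟙       w = w
  reduce s     (a ⁻)   w = reduce (not s) a w

  push-correct : ∀ {n} s (i : Fin n) w ρ → word (push s i w) ρ ≈ (lookup ρ i ^ s) ∙ word w ρ
  push-correct s i [] ρ = ≈-refl
  push-correct s i ((r , j) ∷ w) ρ with i ≟ j
  push-correct true  i ((false , j) ∷ w) ρ | yes refl = ≈-sym (\\-leftDividesˡ (lookup ρ i) (word w ρ))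
  push-correct false i ((true  , j) ∷ w) ρ | yes refl = ≈-sym (\\-leftDividesʳ (lookup ρ i) (word w ρ))
  push-correct true  i ((true  , j) ∷ w) ρ | yes _ = ≈-refl
  push-correct false i ((false , j) ∷ w) ρ | yes _ = ≈-refl
  push-correct true  i ((r , j) ∷ w) ρ | no _ = ≈-refl
  push-correct false i ((r , j) ∷ w) ρ | no _ = ≈-refl

  ^-correct : ∀ x s → x ^ not s ≈ (x ⁻¹) ^ s
  ^-correct x true  = ≈-refl
  ^-correct x false = ≈-sym (⁻¹-involutive x)

  reduce-correct : ∀ {n} s (a : Expr n) w ρ → word (reduce s a w) ρ ≈ (⟦ a ⟧ ρ ^ s) ∙ word w ρ
  reduce-correct s (var i) w ρ = push-correct s i w ρ
  reduce-correct true (a ⊙ b) w ρ =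
    ≈-trans (reduce-correct true a _ ρ) (≈-trans (∙-congˡ (reduce-correct true b w ρ)) (≈-sym (assoc _ _ _)))
  reduce-correct false (a ⊙ b) w ρ =
    ≈-trans (reduce-correct false b _ ρ) (≈-trans (∙-congˡ (reduce-correct false a w ρ))
      (≈-trans (≈-sym (assoc _ _ _)) (∙-congʳ (≈-sym (⁻¹-anti-homo-∙ _ _)))))
  reduce-correct true  𝟙 w ρ = ≈-sym (identityˡ _)
  reduce-correct false 𝟙 w ρ = ≈-sym (≈-trans (∙-congʳ ε⁻¹≈ε) (identityˡ _))
  reduce-correct s (a ⁻) w ρ = ≈-trans (reduce-correct (not s) a w ρ) (∙-congʳ (^-correct (⟦ a ⟧ ρ) s))

  open Reflection setoid var ⟦_⟧ (λ a → word (reduce true a []))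
    (λ a ρ → ≈-trans (reduce-correct true a [] ρ) (identityʳ _)) public
    using (solve; _⊜_)

-- From a nontrivial partition to directions.

group : FinGroup → Group 0ℓ 0ℓ
group Γ = record { isGroup = FinGroup.isGroup Γ }

-- Span g h says that h lies in every subgroup of the family that contains g.  So the elements ≢ ε
-- spanned by some g ≢ ε form a direction, while ε spans only itself: balanced triangles
-- are thus degenerate planes.
record Directions (Γ : FinGroup) : Set₁ where
  open FinGroup Γ renaming (_∙_ to infixl 7 _∙_; _⁻¹ to infixl 8 _⁻¹)
  field
    Span      : Fin order → Fin order → Set
    span?     : ∀ g h → Dec (Span g h)
    span-ε    : ∀ {g} → Span g ε
    span-∙    : ∀ {g h k} → Span g h → Span g k → Span g (h ∙ k)
    span-⁻¹   : ∀ {g h} → Span g h → Span g (h ⁻¹)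
    span-refl : ∀ {g} → Span g g
    span-trans : ∀ {g h k} → Span g h → Span h k → Span g k
    span-sym  : ∀ {g h} → h ≢ ε → Span g h → Span h g
    span-conj : ∀ {g h} x → Span g h → Span (x ⁻¹ ∙ g ∙ x) (x ⁻¹ ∙ h ∙ x)
    span-ε⁻   : ∀ {h} → Span ε h → h ≡ ε
    g₁ g₂     : Fin order
    g₁≢ε      : g₁ ≢ ε
    g₂∉⟨g₁⟩   : ¬ Span g₁ g₂

module _ (Γ : FinGroup) where
  open FinGroup Γ renaming (_∙_ to infixl 7 _∙_; _⁻¹ to infixl 8 _⁻¹)
  open GroupSolver (group Γ) using (solve; _⊜_; _⊙_; _⁻; 𝟙)

  directions : NontrivialPartition Γ → Directions Γ
  directions (k , A , 2≤k , nonempty , ε∉A , cover , disjoint , subgroup) = record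
    { Span       = Span
    ; span?      = λ g h → all? λ i → all? λ x → (_ ∈? H i) →-dec (_ ∈? H i)
    ; span-ε     = λ i x _ → subst (_∈ H i) (sym (solve 1 (λ x → x ⁻ ⊙ 𝟙 ⊙ x ⊜ 𝟙) refl x)) (ε∈H i)
    ; span-∙     = λ {g} {h} {l} p q i x g∈ → subst (_∈ H i)
                     (solve 3 (λ x h l → (x ⁻ ⊙ h ⊙ x) ⊙ (x ⁻ ⊙ l ⊙ x) ⊜ x ⁻ ⊙ (h ⊙ l) ⊙ x) refl x h l)
                     (H-∙ i (p i x g∈) (q i x g∈))
    ; span-⁻¹    = λ {g} {h} p i x g∈ → subst (_∈ H i)
                     (solve 2 (λ x h → (x ⁻ ⊙ h ⊙ x) ⁻ ⊜ x ⁻ ⊙ h ⁻ ⊙ x) refl x h)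
                     (H-⁻¹ i (p i x g∈))
    ; span-refl  = λ i x g∈ → g∈
    ; span-trans = λ p q i x g∈ → q i x (p i x g∈)
    ; span-sym   = span-sym
    -- `Span` quantifies over all conjugators, so conjugating by `y` merely replaces the conjugator
    -- `x` by `y ∙ x`.
    ; span-conj  = λ {g} {h} y p i x g∈ → subst (_∈ H i) (conj-conj x y h)
                     (p i (y ∙ x) (subst (_∈ H i) (sym (conj-conj x y g)) g∈))
    ; span-ε⁻    = span-ε⁻
    -- The two elements come from different parts. Already the trivial conjugator separates them:
    -- otherwise `g₂` would lie in both `H i₁` and `H i₂`.
    ; g₁         = proj₁ (nonempty i₁)
    ; g₂         = proj₁ (nonempty i₂)
    ; g₁≢ε       = ε∉-≢ (proj₂ (nonempty i₁))
    ; g₂∉⟨g₁⟩    = λ p → i₂≢i₁ (H-disjoint (H-ε (p i₁ ε (H-ε⁻ (x∈p∪q⁺ (inj₁ (proj₂ (nonempty i₁)))))))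
                     (x∈p∪q⁺ (inj₁ (proj₂ (nonempty i₂)))) (ε∉-≢ (proj₂ (nonempty i₂))))
    }
    where
    H : Fin k → Subset order
    H i = A i ∪ ⁅ ε ⁆

    -- The subgroups H i need not be permuted by conjugation, so a direction is
    -- a cell of the common refinement of all conjugates of the partition.
    Span : Fin order → Fin order → Set
    Span g h = ∀ i x → x ⁻¹ ∙ g ∙ x ∈ H i → x ⁻¹ ∙ h ∙ x ∈ H i

    ε∈H : ∀ i → ε ∈ H i
    ε∈H i = proj₁ (subgroup i)

    H-∙ : ∀ i {x y} → x ∈ H i → y ∈ H i → x ∙ y ∈ H i
    H-∙ i = proj₁ (proj₂ (subgroup i)) _ _

    H-⁻¹ : ∀ i {x} → x ∈ H i → x ⁻¹ ∈ H i
    H-⁻¹ i = proj₂ (proj₂ (subgroup i)) _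

    ε∉-≢ : ∀ {i x} → x ∈ A i → x ≢ ε
    ε∉-≢ {i} x∈A refl = ε∉A i x∈A

    H⇒A : ∀ {i x} → x ∈ H i → x ≢ ε → x ∈ A i
    H⇒A {i} x∈H x≢ε with x∈p∪q⁻ (A i) ⁅ ε ⁆ x∈H
    ... | inj₁ x∈A = x∈A
    ... | inj₂ x∈ε = contradiction (x∈⁅y⁆⇒x≡y ε x∈ε) x≢ε

    H-disjoint : ∀ {i j x} → x ∈ H i → x ∈ H j → x ≢ ε → j ≡ i
    H-disjoint {i} {j} {x} x∈i x∈j x≢ε = disjoint x j i (H⇒A x∈j x≢ε) (H⇒A x∈i x≢ε)

    i₁ i₂ : Fin k
    i₁ = fromℕ< {0} (<⇒≤ 2≤k)
    i₂ = fromℕ< {1} 2≤k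

    i₂≢i₁ : i₂ ≢ i₁
    i₂≢i₁ eq with () ← fromℕ<-injective 1 0 2≤k (<⇒≤ 2≤k) eq

    conj-ε : ∀ x → ε ⁻¹ ∙ x ∙ ε ≡ x
    conj-ε = solve 1 (λ x → 𝟙 ⁻ ⊙ x ⊙ 𝟙 ⊜ x) refl

    H-ε : ∀ {i x} → ε ⁻¹ ∙ x ∙ ε ∈ H i → x ∈ H i
    H-ε {i} {x} = subst (_∈ H i) (conj-ε x)

    H-ε⁻ : ∀ {i x} → x ∈ H i → ε ⁻¹ ∙ x ∙ ε ∈ H i
    H-ε⁻ {i} {x} = subst (_∈ H i) (sym (conj-ε x))

    conj-conj : ∀ x y h → (y ∙ x) ⁻¹ ∙ h ∙ (y ∙ x) ≡ x ⁻¹ ∙ (y ⁻¹ ∙ h ∙ y) ∙ x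
    conj-conj = solve 3 (λ x y h → (y ⊙ x) ⁻ ⊙ h ⊙ (y ⊙ x) ⊜ x ⁻ ⊙ (y ⁻ ⊙ h ⊙ y) ⊙ x) refl

    unconj : ∀ x h → x ∙ (x ⁻¹ ∙ h ∙ x) ∙ x ⁻¹ ≡ h
    unconj = solve 2 (λ x h → x ⊙ (x ⁻ ⊙ h ⊙ x) ⊙ x ⁻ ⊜ h) refl

    conj≡ε : ∀ x {h} → x ⁻¹ ∙ h ∙ x ≡ ε → h ≡ ε
    conj≡ε x {h} eq = trans (sym (unconj x h)) (trans (cong (λ y → x ∙ y ∙ x ⁻¹) eq)
      (solve 1 (λ x → x ⊙ 𝟙 ⊙ x ⁻ ⊜ 𝟙) refl x))

    -- As `ε` lies in both `H i₁` and `H i₂`, so does `h`, and these subgroups meet only in `ε`.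
    span-ε⁻ : ∀ {h} → Span ε h → h ≡ ε
    span-ε⁻ {h} p with h ≟ ε
    ... | yes h≡ε = h≡ε
    ... | no h≢ε = contradiction (H-disjoint {i₁} {i₂} (H-ε (p i₁ ε (H-ε⁻ (ε∈H i₁)))) (H-ε (p i₂ ε (H-ε⁻ (ε∈H i₂)))) h≢ε) i₂≢i₁

    H-cover : ∀ x → ∃[ i ] (x ∈ H i)
    H-cover x with x ≟ ε
    ... | yes refl = i₁ , ε∈H i₁
    ... | no x≢ε = let i , x∈A = cover x x≢ε in i , x∈p∪q⁺ (inj₁ x∈A)

    -- The conjugate of `g` lies in some `H j`, hence so does that of `h`. This one is not `ε` and
    -- also lies in `H i`, which forces `j` to be `i`.
    span-sym : ∀ {g h} → h ≢ ε → Span g h → Span h g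
    span-sym {g} h≢ε p i x h∈Hi =
      let j , g∈Hj = H-cover (x ⁻¹ ∙ g ∙ x)
      in subst (λ l → x ⁻¹ ∙ g ∙ x ∈ H l) (H-disjoint {i} h∈Hi (p j x g∈Hj) (h≢ε ∘ conj≡ε x)) g∈Hj

-- Frames, gains and the comparison of planes.

module Geometry (Γ : FinGroup) (D : Directions Γ) where
  open FinGroup Γ renaming (_∙_ to infixl 7 _∙_; _⁻¹ to infixl 8 _⁻¹)
  open Directions D
  open GroupSolver (group Γ) using (solve; _⊜_; _⊙_; _⁻; 𝟙)

  -- The classes are oriented cyclically, class `p` running from vertex `p` to vertex `next p`. Thus
  -- `Fin 3` indexes both the classes and the vertices, and a frame assigns a group element to each
  -- vertex.
  next : Fin 3 → Fin 3
  next zero             = suc zero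
  next (suc zero)       = suc (suc zero)
  next (suc (suc zero)) = zero

  next≢ : ∀ p → next p ≢ p
  next≢ zero ()
  next≢ (suc zero) ()
  next≢ (suc (suc zero)) ()

  ≢⇒next : ∀ {p q} → p ≢ q → q ≡ next p ⊎ p ≡ next q
  ≢⇒next {zero} {zero} p≢q = contradiction refl p≢q
  ≢⇒next {zero} {suc zero} _ = inj₁ refl
  ≢⇒next {zero} {suc (suc zero)} _ = inj₂ refl
  ≢⇒next {suc zero} {zero} _ = inj₂ refl
  ≢⇒next {suc zero} {suc zero} p≢q = contradiction refl p≢q
  ≢⇒next {suc zero} {suc (suc zero)} _ = inj₁ refl
  ≢⇒next {suc (suc zero)} {zero} _ = inj₁ refl
  ≢⇒next {suc (suc zero)} {suc zero} _ = inj₂ refl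
  ≢⇒next {suc (suc zero)} {suc (suc zero)} p≢q = contradiction refl p≢q

  -- Case analysis that starts at an arbitrary `p`, so that constructions can use the cyclic
  -- symmetry instead of being repeated for each class.
  rotate : ∀ {ℓ} (P : Fin 3 → Set ℓ) p → P p → P (next p) → P (next (next p)) → ∀ r → P r
  rotate P zero             x y z zero             = x
  rotate P zero             x y z (suc zero)       = y
  rotate P zero             x y z (suc (suc zero)) = z
  rotate P (suc zero)       x y z zero             = z
  rotate P (suc zero)       x y z (suc zero)       = x
  rotate P (suc zero)       x y z (suc (suc zero)) = y
  rotate P (suc (suc zero)) x y z zero             = y
  rotate P (suc (suc zero)) x y z (suc zero)       = z
  rotate P (suc (suc zero)) x y z (suc (suc zero)) = x

  Frame : Set
  Frame = Fin 3 → Fin order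

  at : Fin 3 → Fin order → Fin order → Fin order → Frame
  at = rotate (λ _ → Fin order)

  at₀ : ∀ p x y z → at p x y z p ≡ x
  at₀ zero x y z = refl
  at₀ (suc zero) x y z = refl
  at₀ (suc (suc zero)) x y z = refl

  at₁ : ∀ p x y z → at p x y z (next p) ≡ y
  at₁ zero x y z = refl
  at₁ (suc zero) x y z = refl
  at₁ (suc (suc zero)) x y z = refl

  at₂ : ∀ p x y z → at p x y z (next (next p)) ≡ z
  at₂ zero x y z = refl
  at₂ (suc zero) x y z = refl
  at₂ (suc (suc zero)) x y z = refl

  gain : Frame → Fin 3 → Fin order → Fin order
  gain t p α = t p ⁻¹ ∙ α ∙ t (next p)

  gain-≡ : ∀ t r {γ a b} → t r ≡ a → t (next r) ≡ b → gain t r γ ≡ a ⁻¹ ∙ γ ∙ b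
  gain-≡ t r refl refl = refl

  ≡ε⇒span : ∀ {g h} → h ≡ ε → Span g h
  ≡ε⇒span h≡ε = subst (Span _) (sym h≡ε) span-ε

  span-weaken : ∀ {g h} → Span ε h → Span g h
  span-weaken s = ≡ε⇒span (span-ε⁻ s)

  -- Replacing the frame t by t′ r = t r ∙ h r ∙ x with all h r in ⟨ g ⟩ conjugates ⟨ g ⟩ by x.
  module Regauge (t t′ : Frame) {g : Fin order} (x : Fin order)
                 (h∈ : ∀ r → Span g (t r ⁻¹ ∙ t′ r ∙ x ⁻¹)) where

    regauge : ∀ r {γ} → Span g (gain t r γ) → Span (x ⁻¹ ∙ g ∙ x) (gain t′ r γ)
    regauge r {γ} s = subst (Span _)
      (solve 6 (λ a b a′ b′ x γ → x ⁻ ⊙ ((a ⁻ ⊙ a′ ⊙ x ⁻) ⁻ ⊙ (a ⁻ ⊙ γ ⊙ b) ⊙ (b ⁻ ⊙ b′ ⊙ x ⁻)) ⊙ x ⊜ a′ ⁻ ⊙ γ ⊙ b′)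
        refl (t r) (t (next r)) (t′ r) (t′ (next r)) x γ)
      (span-conj x (span-∙ (span-∙ (span-⁻¹ (h∈ r)) s) (h∈ (next r))))

    regauge⁻ : ∀ r {γ} → Span (x ⁻¹ ∙ g ∙ x) (gain t′ r γ) → Span g (gain t r γ)
    regauge⁻ r {γ} s = subst (Span _)
      (solve 6 (λ a b a′ b′ x γ → (a ⁻ ⊙ a′ ⊙ x ⁻) ⊙ (x ⊙ (a′ ⁻ ⊙ γ ⊙ b′) ⊙ x ⁻) ⊙ (b ⁻ ⊙ b′ ⊙ x ⁻) ⁻ ⊜ a ⁻ ⊙ γ ⊙ b)
        refl (t r) (t (next r)) (t′ r) (t′ (next r)) x γ)
      (span-∙ (span-∙ (h∈ r) unconj) (span-⁻¹ (h∈ (next r))))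
      where
      -- Conjugating `s` by `x ⁻¹` undoes the conjugation on both sides of `Span`.
      unconj : Span g (x ∙ gain t′ r γ ∙ x ⁻¹)
      unconj = subst (λ k → Span k _)
        (solve 2 (λ x g → x ⁻ ⁻ ⊙ (x ⁻ ⊙ g ⊙ x) ⊙ x ⁻ ⊜ g) refl x g)
        (subst (Span _)
          (solve 2 (λ x k → x ⁻ ⁻ ⊙ k ⊙ x ⁻ ⊜ x ⊙ k ⊙ x ⁻) refl x (gain t′ r γ))
          (span-conj (x ⁻¹) s))

  -- The frame depends on the two edges alone, and by `rebased` every `sub` plane through both can
  -- be rewritten in it. Such planes are then compared through the directions `g₀` only; the last
  -- clause of `rebased` keeps triangles triangles.
  record Joining (p : Fin 3) (α : Fin order) (q : Fin 3) (β : Fin order) : Set where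
    field
      frame     : Frame
      first     : Span ε (gain frame p α)
      second    : Span ε (gain frame q β)
      rebased   : ∀ t {g} → Span g (gain t p α) → Span g (gain t q β) →
                  ∃[ g₀ ] ( (∀ r {γ} → Span g (gain t r γ) → Span g₀ (gain frame r γ))
                          × (∀ r {γ} → Span g₀ (gain frame r γ) → Span g (gain t r γ))
                          × (g ≡ ε → g₀ ≡ ε))

  joining-next : ∀ p α β → Joining p α (next p) β
  joining-next p α β = record
    { frame   = frame
    ; first   = ≡ε⇒span (trans (gain-≡ frame p (at₀ p _ _ _) (at₁ p _ _ _)) (solve 1 (λ α → α ⁻ ⊙ α ⊙ 𝟙 ⊜ 𝟙) refl α))
    ; second  = ≡ε⇒span (trans (gain-≡ frame (next p) (at₁ p _ _ _) (at₂ p _ _ _)) (solve 1 (λ β → 𝟙 ⁻ ⊙ β ⊙ β ⁻ ⊜ 𝟙) refl β))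
    ; rebased = rebased
    }
    where
    frame : Frame
    -- Put `ε` at the common vertex `next p`; trivial gains then force the values at the other two.
    frame = at p α ε (β ⁻¹)

    rebased : ∀ t {g} → Span g (gain t p α) → Span g (gain t (next p) β) →
              ∃[ g₀ ] ( (∀ r {γ} → Span g (gain t r γ) → Span g₀ (gain frame r γ))
                      × (∀ r {γ} → Span g₀ (gain frame r γ) → Span g (gain t r γ))
                      × (g ≡ ε → g₀ ≡ ε))
    rebased t {g} α∈ β∈ = x ⁻¹ ∙ g ∙ x , regauge , regauge⁻ ,
      λ { refl → solve 1 (λ x → x ⁻ ⊙ 𝟙 ⊙ x ⊜ 𝟙) refl x }
      where
      u = t (next p)
      -- This choice makes the correction at the common vertex trivial. At the other two vertices it
      -- is the gain of `α` and the inverse of the gain of `β`, which `g` spans by assumption.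
      x = u ⁻¹
      h∈ : ∀ r → Span g (t r ⁻¹ ∙ frame r ∙ x ⁻¹)
      h∈ = rotate _ p
        (subst (Span g)
          (trans (solve 3 (λ a α u → a ⁻ ⊙ α ⊙ u ⊜ a ⁻ ⊙ α ⊙ u ⁻ ⁻) refl (t p) α u)
                 (cong (λ y → t p ⁻¹ ∙ y ∙ x ⁻¹) (sym (at₀ p _ _ _))))
          α∈)
        (≡ε⇒span (trans (cong (λ y → u ⁻¹ ∙ y ∙ x ⁻¹) (at₁ p _ _ _)) (solve 1 (λ u → u ⁻ ⊙ 𝟙 ⊙ u ⁻ ⁻ ⊜ 𝟙) refl u)))
        (subst (Span g)
          (trans (solve 3 (λ a β u → (u ⁻ ⊙ β ⊙ a) ⁻ ⊜ a ⁻ ⊙ β ⁻ ⊙ u ⁻ ⁻) refl (t (next (next p))) β u)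
                 (cong (λ y → t (next (next p)) ⁻¹ ∙ y ∙ x ⁻¹) (sym (at₂ p _ _ _))))
          (span-⁻¹ β∈))
      open Regauge t frame x h∈

  joining : ∀ {p q} → p ≢ q → ∀ α β → Joining p α q β
  joining {p} {q} p≢q α β with ≢⇒next p≢q
  ... | inj₁ refl = joining-next p α β
  ... | inj₂ refl = record
    { frame   = frame
    ; first   = second
    ; second  = first
    ; rebased = λ t α∈ β∈ → rebased t β∈ α∈
    } where open Joining (joining-next q β α)

  -- In the joining frame the triangle still has direction `ε`, so its edges have trivial gain
  -- there, and trivial gains are spanned by every direction.
  tri⊆plane : ∀ {p q α β} t t′ {g} → p ≢ q → Span ε (gain t p α) → Span ε (gain t q β) →
              Span g (gain t′ p α) → Span g (gain t′ q β) →
              ∀ r {γ} → Span ε (gain t r γ) → Span g (gain t′ r γ)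
  tri⊆plane {α = α} {β} t t′ p≢q a b a′ b′ r s =
    let open Joining (joining p≢q α β)
        g₀ , to₀ , from₀ , ε-case = rebased t a b
        g₁ , to₁ , from₁ , _      = rebased t′ a′ b′
    in from₁ r (span-weaken (subst (λ k → Span k _) (ε-case refl) (to₀ r s)))

  -- In the joining frame of the first two edges the third has a nontrivial gain. Both directions
  -- span this gain, so by `span-sym` it determines them.
  plane⊆plane : ∀ {p q α β r₀ γ₀} t t′ {g g′} (p≢q : p ≢ q) →
                ¬ Span ε (gain (Joining.frame (joining p≢q α β)) r₀ γ₀) →
                Span g (gain t p α) → Span g (gain t q β) → Span g (gain t r₀ γ₀) →
                Span g′ (gain t′ p α) → Span g′ (gain t′ q β) → Span g′ (gain t′ r₀ γ₀) →
                ∀ r {γ} → Span g (gain t r γ) → Span g′ (gain t′ r γ)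
  plane⊆plane {α = α} {β} {r₀} t t′ p≢q c∉ a b c a′ b′ c′ r s =
    let open Joining (joining p≢q α β)
        g₀ , to₀ , from₀ , _ = rebased t a b
        g₁ , to₁ , from₁ , _ = rebased t′ a′ b′
    in from₁ r (span-trans (to₁ r₀ c′) (span-trans (span-sym (c∉ ∘ ≡ε⇒span) (to₀ r₀ c)) (to₀ r s)))

  -- The difference `α ⁻¹ ∙ β`, conjugated by the frame value at the head of the class, is
  -- nontrivial and so determines the direction. Conjugation by `u ⁻¹ ∙ u′` carries it from one
  -- frame to the other.
  coset⊆coset : ∀ {p α β} t t′ {g g′} → α ≢ β → Span g (gain t p α) → Span g (gain t p β) →
                Span g′ (gain t′ p α) → Span g′ (gain t′ p β) →
                ∀ {γ} → Span g (gain t p γ) → Span g′ (gain t′ p γ)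
  coset⊆coset {p} {α} {β} t t′ {g} {g′} α≢β a b a′ b′ {γ} c = subst (Span g′)
    (solve 4 (λ s u α γ → (s ⁻ ⊙ α ⊙ u) ⊙ (u ⁻ ⊙ (α ⁻ ⊙ γ) ⊙ u) ⊜ s ⁻ ⊙ γ ⊙ u) refl (t′ p) u′ α γ)
    (span-∙ a′ (span-trans (difference t′ a′ b′) (transport (span-trans (span-sym k≢ε (difference t a b)) (difference t a c)))))
    where
    u  = t (next p)
    u′ = t′ (next p)

    difference : ∀ t {g α β} → Span g (gain t p α) → Span g (gain t p β) →
                 Span g (t (next p) ⁻¹ ∙ (α ⁻¹ ∙ β) ∙ t (next p))
    difference t {g} {α} {β} a b = subst (Span g)
      (solve 4 (λ s u α β → (s ⁻ ⊙ α ⊙ u) ⁻ ⊙ (s ⁻ ⊙ β ⊙ u) ⊜ u ⁻ ⊙ (α ⁻ ⊙ β) ⊙ u) refl (t p) (t (next p)) α β)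
      (span-∙ (span-⁻¹ a) b)

    k≢ε : u ⁻¹ ∙ (α ⁻¹ ∙ β) ∙ u ≢ ε
    k≢ε eq = α≢β (trans (solve 2 (λ α u → α ⊜ α ⊙ u ⊙ 𝟙 ⊙ u ⁻) refl α u)
      (trans (cong (λ k → α ∙ u ∙ k ∙ u ⁻¹) (sym eq))
             (solve 3 (λ α β u → α ⊙ u ⊙ (u ⁻ ⊙ (α ⁻ ⊙ β) ⊙ u) ⊙ u ⁻ ⊜ β) refl α β u)))

    transport : ∀ {k l} → Span (u ⁻¹ ∙ k ∙ u) (u ⁻¹ ∙ l ∙ u) → Span (u′ ⁻¹ ∙ k ∙ u′) (u′ ⁻¹ ∙ l ∙ u′)
    transport {k} {l} s = subst₂ Span (move k) (move l) (span-conj (u ⁻¹ ∙ u′) s)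
      where
      move : ∀ k → (u ⁻¹ ∙ u′) ⁻¹ ∙ (u ⁻¹ ∙ k ∙ u) ∙ (u ⁻¹ ∙ u′) ≡ u′ ⁻¹ ∙ k ∙ u′
      move = solve 3 (λ u u′ k → (u ⁻ ⊙ u′) ⁻ ⊙ (u ⁻ ⊙ k ⊙ u) ⊙ (u ⁻ ⊙ u′) ⊜ u′ ⁻ ⊙ k ⊙ u′) refl u u′

  -- The label in class `p` of the triangle with frame `t`.
  tri-point : Frame → Fin 3 → Fin order
  tri-point t p = t p ∙ t (next p) ⁻¹

  tri-point-unique : ∀ t p {α} → Span ε (gain t p α) → α ≡ tri-point t p
  tri-point-unique t p {α} s = trans
    (solve 3 (λ a b α → α ⊜ a ⊙ (a ⁻ ⊙ α ⊙ b) ⊙ b ⁻) refl (t p) (t (next p)) α)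
    (trans (cong (λ k → t p ∙ k ∙ t (next p) ⁻¹) (span-ε⁻ s))
           (solve 2 (λ a b → a ⊙ 𝟙 ⊙ b ⁻ ⊜ a ⊙ b ⁻) refl (t p) (t (next p))))

  tri-injective : ∀ t p {α β} → Span ε (gain t p α) → Span ε (gain t p β) → α ≡ β
  tri-injective t p a b = trans (tri-point-unique t p a) (sym (tri-point-unique t p b))

  -- Points, lines and planes of the extended geometry.

  data Point : Set where
    e : Fin 3 → Fin order → Point
    f : Fin 2 → Point

  -- The two-point lines `fe` and `ff` express that the added points are generic. A `coset` of
  -- direction `ε` is a single point; this is harmless, since lines are compared only at two
  -- distinct points.
  data Line : Set where
    tri   : Frame → Line
    coset : Fin 3 → Frame → Fin order → Line
    fe    : Fin 2 → Fin 3 → Fin order → Line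
    ff    : Line

  data Plane : Set where
    class : Fin 3 → Plane
    ft    : Fin 2 → Frame → Plane
    sub   : Frame → Fin order → Plane

  infix 4 _∈ˡ_ _∈ᵖ_ _∈ˡ?_ _∈ᵖ?_

  data _∈ˡ_ : Point → Line → Set where
    on-tri   : ∀ {t p α} → Span ε (gain t p α) → e p α ∈ˡ tri t
    on-coset : ∀ {t g p α} → Span g (gain t p α) → e p α ∈ˡ coset p t g
    on-fe-f  : ∀ {i p α} → f i ∈ˡ fe i p α
    on-fe-e  : ∀ {i p α} → e p α ∈ˡ fe i p α
    on-ff    : ∀ {i} → f i ∈ˡ ff

  data _∈ᵖ_ : Point → Plane → Set where
    e∈class : ∀ {p α} → e p α ∈ᵖ class p
    f∈class : ∀ {p i} → f i ∈ᵖ class p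
    e∈ft    : ∀ {t i p α} → Span ε (gain t p α) → e p α ∈ᵖ ft i t
    f∈ft    : ∀ {t i} → f i ∈ᵖ ft i t
    e∈sub   : ∀ {t g p α} → Span g (gain t p α) → e p α ∈ᵖ sub t g

  _∈ˡ?_ : ∀ x ℓ → Dec (x ∈ˡ ℓ)
  e p α ∈ˡ? tri t = map′ on-tri (λ { (on-tri s) → s }) (span? _ _)
  e p α ∈ˡ? coset q t g with p ≟ q
  ... | yes refl = map′ on-coset (λ { (on-coset s) → s }) (span? _ _)
  ... | no p≢q   = no λ { (on-coset _) → p≢q refl }
  e p α ∈ˡ? fe i q β with p ≟ q | α ≟ β
  ... | yes refl | yes refl = yes on-fe-e
  ... | no p≢q   | _        = no λ { on-fe-e → p≢q refl }
  ... | _        | no α≢β   = no λ { on-fe-e → α≢β refl }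
  e p α ∈ˡ? ff = no λ ()
  f i ∈ˡ? tri t = no λ ()
  f i ∈ˡ? coset q t g = no λ ()
  f i ∈ˡ? fe j q β with i ≟ j
  ... | yes refl = yes on-fe-f
  ... | no i≢j   = no λ { on-fe-f → i≢j refl }
  f i ∈ˡ? ff = yes on-ff

  _∈ᵖ?_ : ∀ x π → Dec (x ∈ᵖ π)
  e p α ∈ᵖ? class q with p ≟ q
  ... | yes refl = yes e∈class
  ... | no p≢q   = no λ { e∈class → p≢q refl }
  e p α ∈ᵖ? ft i t  = map′ e∈ft (λ { (e∈ft s) → s }) (span? _ _)
  e p α ∈ᵖ? sub t g = map′ e∈sub (λ { (e∈sub s) → s }) (span? _ _)
  f i ∈ᵖ? class q = yes f∈class
  f i ∈ᵖ? ft j t with i ≟ j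
  ... | yes refl = yes f∈ft
  ... | no i≢j   = no λ { f∈ft → i≢j refl }
  f i ∈ᵖ? sub t g = no λ ()

  -- The incidence axioms.

  line-through : ∀ x y → x ≢ y → ∃[ ℓ ] (x ∈ˡ ℓ × y ∈ˡ ℓ)
  line-through (e p α) (e q β) x≢y with p ≟ q
  ... | no p≢q = let open Joining (joining p≢q α β) in tri frame , on-tri first , on-tri second
  -- For parallel edges any frame in which `α` has trivial gain will do, so the second edge is given
  -- the arbitrary label `ε`; the gain of `β` is then the direction.
  ... | yes refl = let open Joining (joining-next p α ε) in
    coset p frame (gain frame p β) , on-coset (span-weaken first) , on-coset span-refl
  line-through (e p α) (f i) _ = fe i p α , on-fe-e , on-fe-f
  line-through (f i) (e p α) _ = fe i p α , on-fe-f , on-fe-e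
  line-through (f i) (f j)   _ = ff , on-ff , on-ff

  -- A triangle has one edge in each class, so lines of different kinds share at most one point. Two
  -- triangles are compared by `tri⊆plane` with direction `ε`.
  line-unique : ∀ {x y z} ℓ ℓ′ → x ≢ y → x ∈ˡ ℓ → y ∈ˡ ℓ → x ∈ˡ ℓ′ → y ∈ˡ ℓ′ → z ∈ˡ ℓ → z ∈ˡ ℓ′
  line-unique (tri t) (tri t′) x≢y (on-tri {p = p} a) (on-tri {p = q} b) (on-tri a′) (on-tri b′) (on-tri {p = r} c)
    with p ≟ q
  ... | yes refl = contradiction (cong (e p) (tri-injective t p a b)) x≢y
  ... | no p≢q = on-tri (tri⊆plane t t′ p≢q a b a′ b′ r c)
  line-unique (tri t) (coset p _ _) x≢y (on-tri a) (on-tri b) (on-coset _) (on-coset _) _ =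
    contradiction (cong (e p) (tri-injective t p a b)) x≢y
  line-unique (tri t) (fe _ _ _) x≢y (on-tri a) (on-tri b) on-fe-e on-fe-e _ = contradiction refl x≢y
  line-unique (coset p t g) (tri t′) x≢y (on-coset a) (on-coset b) (on-tri a′) (on-tri b′) _ =
    contradiction (cong (e p) (tri-injective t′ p a′ b′)) x≢y
  line-unique (coset p t g) (coset _ t′ g′) x≢y (on-coset a) (on-coset b) (on-coset a′) (on-coset b′) (on-coset c) =
    on-coset (coset⊆coset t t′ (x≢y ∘ cong (e p)) a b a′ b′ c)
  line-unique (coset p t g) (fe _ _ _) x≢y (on-coset _) (on-coset _) on-fe-e on-fe-e _ = contradiction refl x≢y
  line-unique (fe _ _ _) _ x≢y on-fe-f on-fe-f _ _ _ = contradiction refl x≢y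
  line-unique (fe _ _ _) _ x≢y on-fe-e on-fe-e _ _ _ = contradiction refl x≢y
  line-unique (fe _ _ _) _ x≢y on-fe-f on-fe-e x∈ y∈ on-fe-f = x∈
  line-unique (fe _ _ _) _ x≢y on-fe-f on-fe-e x∈ y∈ on-fe-e = y∈
  line-unique (fe _ _ _) _ x≢y on-fe-e on-fe-f x∈ y∈ on-fe-f = y∈
  line-unique (fe _ _ _) _ x≢y on-fe-e on-fe-f x∈ y∈ on-fe-e = x∈
  line-unique ff (fe _ _ _) x≢y on-ff on-ff on-fe-f on-fe-f _ = contradiction refl x≢y
  line-unique ff ff _ _ _ _ _ z∈ = z∈

  plane-through : ∀ ℓ z → ∃[ π ] ((∀ {x} → x ∈ˡ ℓ → x ∈ᵖ π) × z ∈ᵖ π)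
  plane-through (tri t) (e r γ) = sub t (gain t r γ) ,
    (λ { (on-tri s) → e∈sub (span-weaken s) }) , e∈sub span-refl
  plane-through (tri t) (f i) = ft i t , (λ { (on-tri s) → e∈ft s }) , f∈ft
  plane-through (coset p t g) (f i) = class p , (λ { (on-coset _) → e∈class }) , f∈class
  plane-through (coset p t g) (e q γ) with p ≟ q
  ... | yes refl = class p , (λ { (on-coset _) → e∈class }) , e∈class
  ... | no p≢q with ≢⇒next p≢q
  -- The new frame agrees with `t` at both ends of class `p`, which preserves the coset; its value
  -- at the third vertex makes the gain of `γ` trivial.
  ... | inj₁ refl = sub t′ g ,
    (λ { (on-coset s) → e∈sub (subst (Span g) (sym (gain-≡ t′ p (at₀ p _ _ _) (at₁ p _ _ _))) s) }) ,
    e∈sub (≡ε⇒span (trans (gain-≡ t′ (next p) (at₁ p _ _ _) (at₂ p _ _ _))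
      (solve 2 (λ u γ → u ⁻ ⊙ γ ⊙ (γ ⁻ ⊙ u) ⊜ 𝟙) refl (t (next p)) γ)))
    where t′ = at p (t p) (t (next p)) (γ ⁻¹ ∙ t (next p))
  ... | inj₂ refl = sub t′ g ,
    (λ { (on-coset s) → e∈sub (subst (Span g) (sym (gain-≡ t′ p (at₁ q _ _ _) (at₂ q _ _ _))) s) }) ,
    e∈sub (≡ε⇒span (trans (gain-≡ t′ q (at₀ q _ _ _) (at₁ q _ _ _))
      (solve 2 (λ u γ → (γ ⊙ u) ⁻ ⊙ γ ⊙ u ⊜ 𝟙) refl (t p) γ)))
    where t′ = at q (γ ∙ t p) (t p) (t (next p))
  plane-through (fe i p α) (e q γ) with p ≟ q
  ... | yes refl = class p , (λ { on-fe-f → f∈class ; on-fe-e → e∈class }) , e∈class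
  ... | no p≢q = let open Joining (joining p≢q α γ) in
    ft i frame , (λ { on-fe-f → f∈ft ; on-fe-e → e∈ft first }) , e∈ft second
  plane-through (fe i p α) (f j) = class p , (λ { on-fe-f → f∈class ; on-fe-e → e∈class }) , f∈class
  plane-through ff (e p α) = class p , (λ { on-ff → f∈class }) , e∈class
  -- All three class planes contain `ff`; the choice of `zero` is arbitrary.
  plane-through ff (f i)   = class zero , (λ { on-ff → f∈class }) , f∈class

  line⊆plane : ∀ {x y z} ℓ π → x ≢ y → x ∈ˡ ℓ → y ∈ˡ ℓ → x ∈ᵖ π → y ∈ᵖ π → z ∈ˡ ℓ → z ∈ᵖ π
  line⊆plane (tri t) (class p) x≢y (on-tri a) (on-tri b) e∈class e∈class _ =
    contradiction (cong (e p) (tri-injective t p a b)) x≢y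
  line⊆plane (tri t) (ft i t′) x≢y (on-tri {p = p} a) (on-tri {p = q} b) (e∈ft a′) (e∈ft b′) (on-tri {p = r} c)
    with p ≟ q
  ... | yes refl = contradiction (cong (e p) (tri-injective t p a b)) x≢y
  ... | no p≢q = e∈ft (tri⊆plane t t′ p≢q a b a′ b′ r c)
  line⊆plane (tri t) (sub t′ g) x≢y (on-tri {p = p} a) (on-tri {p = q} b) (e∈sub a′) (e∈sub b′) (on-tri {p = r} c)
    with p ≟ q
  ... | yes refl = contradiction (cong (e p) (tri-injective t p a b)) x≢y
  ... | no p≢q = e∈sub (tri⊆plane t t′ p≢q a b a′ b′ r c)
  line⊆plane (coset p t g) (class _) x≢y (on-coset _) (on-coset _) e∈class e∈class (on-coset _) = e∈class
  line⊆plane (coset p t g) (ft i t′) x≢y (on-coset _) (on-coset _) (e∈ft a) (e∈ft b) _ =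
    contradiction (cong (e p) (tri-injective t′ p a b)) x≢y
  line⊆plane (coset p t g) (sub t′ g′) x≢y (on-coset a) (on-coset b) (e∈sub a′) (e∈sub b′) (on-coset c) =
    e∈sub (coset⊆coset t t′ (x≢y ∘ cong (e p)) a b a′ b′ c)
  line⊆plane (fe _ _ _) _ x≢y on-fe-f on-fe-f _ _ _ = contradiction refl x≢y
  line⊆plane (fe _ _ _) _ x≢y on-fe-e on-fe-e _ _ _ = contradiction refl x≢y
  line⊆plane (fe _ _ _) _ x≢y on-fe-f on-fe-e x∈ y∈ on-fe-f = x∈
  line⊆plane (fe _ _ _) _ x≢y on-fe-f on-fe-e x∈ y∈ on-fe-e = y∈
  line⊆plane (fe _ _ _) _ x≢y on-fe-e on-fe-f x∈ y∈ on-fe-f = y∈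
  line⊆plane (fe _ _ _) _ x≢y on-fe-e on-fe-f x∈ y∈ on-fe-e = x∈
  line⊆plane ff (class p) _ on-ff on-ff _ _ on-ff = f∈class
  line⊆plane ff (ft i t) x≢y on-ff on-ff f∈ft f∈ft _ = contradiction refl x≢y


  tri-point-on : ∀ t p → Span ε (gain t p (tri-point t p))
  tri-point-on t p = ≡ε⇒span (solve 2 (λ a b → a ⁻ ⊙ (a ⊙ b ⁻) ⊙ b ⊜ 𝟙) refl (t p) (t (next p)))

  -- This and the next four lemmas name a line containing the intersection of two planes; such
  -- planes cannot share three noncollinear points.
  class∩class : ∀ {p q x} → p ≢ q → x ∈ᵖ class p → x ∈ᵖ class q → x ∈ˡ ff
  class∩class p≢q e∈class e∈class = contradiction refl p≢q
  class∩class p≢q f∈class f∈class = on-ff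

  class∩ft : ∀ {p i t x} → x ∈ᵖ class p → x ∈ᵖ ft i t → x ∈ˡ fe i p (tri-point t p)
  class∩ft {p} {i} {t} e∈class (e∈ft s) = subst (λ α → e p α ∈ˡ fe i p (tri-point t p)) (sym (tri-point-unique t p s)) on-fe-e
  class∩ft f∈class f∈ft = on-fe-f

  class∩sub : ∀ {p t g x} → x ∈ᵖ class p → x ∈ᵖ sub t g → x ∈ˡ coset p t g
  class∩sub e∈class (e∈sub s) = on-coset s

  ft∩sub : ∀ {i t t′ g x} → x ∈ᵖ ft i t → x ∈ᵖ sub t′ g → x ∈ˡ tri t
  ft∩sub (e∈ft s) (e∈sub _) = on-tri s

  ft∩ft : ∀ {i j t t′ x} → i ≢ j → x ∈ᵖ ft i t → x ∈ᵖ ft j t′ → x ∈ˡ tri t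
  ft∩ft i≢j (e∈ft s) (e∈ft _) = on-tri s
  ft∩ft i≢j f∈ft f∈ft = contradiction refl i≢j

  Agree : Frame → Frame → Fin 3 → Set
  Agree t t′ p = tri-point t p ≡ tri-point t′ p

  -- Two edges of different classes determine the triangle through them.
  agree-twice : ∀ {p q} i t t′ → p ≢ q → Agree t t′ p → Agree t t′ q → ∀ {x} → x ∈ᵖ ft i t → x ∈ᵖ ft i t′
  agree-twice i t t′ p≢q a b f∈ft = f∈ft
  agree-twice {p} {q} i t t′ p≢q a b (e∈ft s) = e∈ft
    (tri⊆plane t t′ p≢q (tri-point-on t p) (tri-point-on t q) (on t′ a) (on t′ b) _ s)
    where
    on : ∀ t′ {p α} → α ≡ tri-point t′ p → Span ε (gain t′ p α)
    on t′ {p} refl = tri-point-on t′ p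

  -- The triangles can share an edge only in class `p`, so besides `f i` at most one point is common
  -- to the planes.
  agree-once : ∀ p i t t′ → (∀ r → r ≢ p → ¬ Agree t t′ r) →
               ∀ {x} → x ∈ᵖ ft i t → x ∈ᵖ ft i t′ → x ∈ˡ fe i p (tri-point t p)
  agree-once p i t t′ only f∈ft f∈ft = on-fe-f
  agree-once p i t t′ only (e∈ft {p = r} s) (e∈ft s′) with r ≟ p
  ... | yes refl = subst (λ α → e p α ∈ˡ fe i p (tri-point t p)) (sym (tri-point-unique t p s)) on-fe-e
  ... | no r≢p = contradiction (trans (sym (tri-point-unique t r s)) (tri-point-unique t′ r s′)) (only r r≢p)

  ft⊆ft⊎meet-in-line : ∀ i t t′ → (∀ {x} → x ∈ᵖ ft i t → x ∈ᵖ ft i t′)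
                     ⊎ ∃[ ℓ ] (∀ {x} → x ∈ᵖ ft i t → x ∈ᵖ ft i t′ → x ∈ˡ ℓ)
  ft⊆ft⊎meet-in-line i t t′ = compare (agree? zero) (agree? (suc zero)) (agree? (suc (suc zero)))
    where
    agree? : ∀ p → Dec (Agree t t′ p)
    agree? p = tri-point t p ≟ tri-point t′ p

    meet : ∀ p → ¬ Agree t t′ (next p) → ¬ Agree t t′ (next (next p)) →
           ∃[ ℓ ] (∀ {x} → x ∈ᵖ ft i t → x ∈ᵖ ft i t′ → x ∈ˡ ℓ)
    meet p ¬a ¬b = fe i p (tri-point t p) , agree-once p i t t′
      (rotate _ p (contradiction refl) (λ _ → ¬a) (λ _ → ¬b))

    compare : Dec (Agree t t′ zero) → Dec (Agree t t′ (suc zero)) → Dec (Agree t t′ (suc (suc zero))) →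
              (∀ {x} → x ∈ᵖ ft i t → x ∈ᵖ ft i t′)
              ⊎ ∃[ ℓ ] (∀ {x} → x ∈ᵖ ft i t → x ∈ᵖ ft i t′ → x ∈ˡ ℓ)
    compare (yes a) (yes b) _       = inj₁ (agree-twice i t t′ (λ ()) a b)
    compare (yes a) (no _)  (yes c) = inj₁ (agree-twice i t t′ (λ ()) a c)
    compare (no _)  (yes b) (yes c) = inj₁ (agree-twice i t t′ (λ ()) b c)
    compare (yes _) (no b)  (no c)  = inj₂ (meet zero b c)
    compare (no a)  (yes _) (no c)  = inj₂ (meet (suc zero) c a)
    -- This clause also covers triangles without a common edge.
    compare (no a)  (no b)  _       = inj₂ (meet (suc (suc zero)) a b)

  plane-unique : ∀ {x y z w} π π′ → (∀ ℓ → ¬ (x ∈ˡ ℓ × y ∈ˡ ℓ × z ∈ˡ ℓ)) →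
                 x ∈ᵖ π → y ∈ᵖ π → z ∈ᵖ π → x ∈ᵖ π′ → y ∈ᵖ π′ → z ∈ᵖ π′ → w ∈ᵖ π → w ∈ᵖ π′
  plane-unique (class p) (class q) noncol x y z x′ y′ z′ w with p ≟ q
  ... | yes refl = w
  ... | no p≢q = contradiction (class∩class p≢q x x′ , class∩class p≢q y y′ , class∩class p≢q z z′) (noncol ff)
  plane-unique (class p) (ft i t) noncol x y z x′ y′ z′ w =
    contradiction (class∩ft x x′ , class∩ft y y′ , class∩ft z z′) (noncol _)
  plane-unique (class p) (sub t g) noncol x y z x′ y′ z′ w =
    contradiction (class∩sub x x′ , class∩sub y y′ , class∩sub z z′) (noncol _)
  plane-unique (ft i t) (class p) noncol x y z x′ y′ z′ w =
    contradiction (class∩ft x′ x , class∩ft y′ y , class∩ft z′ z) (noncol _)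
  plane-unique (ft i t) (ft j t′) noncol x y z x′ y′ z′ w with i ≟ j
  ... | no i≢j = contradiction (ft∩ft i≢j x x′ , ft∩ft i≢j y y′ , ft∩ft i≢j z z′) (noncol _)
  ... | yes refl with ft⊆ft⊎meet-in-line i t t′
  ... | inj₁ ft⊆ft = ft⊆ft w
  ... | inj₂ (ℓ , meet) = contradiction (meet x x′ , meet y y′ , meet z z′) (noncol ℓ)
  plane-unique (ft i t) (sub t′ g) noncol x y z x′ y′ z′ w =
    contradiction (ft∩sub x x′ , ft∩sub y y′ , ft∩sub z z′) (noncol _)
  plane-unique (sub t g) (class p) noncol x y z x′ y′ z′ w =
    contradiction (class∩sub x′ x , class∩sub y′ y , class∩sub z′ z) (noncol _)
  plane-unique (sub t g) (ft i t′) noncol x y z x′ y′ z′ w =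
    contradiction (ft∩sub x′ x , ft∩sub y′ y , ft∩sub z′ z) (noncol _)
  plane-unique (sub t g) (sub t′ g′) noncol (e∈sub {p = p} {α} a) (e∈sub {p = q} {β} b) (e∈sub {p = r} {γ} c)
               (e∈sub a′) (e∈sub b′) (e∈sub c′) (e∈sub d) with p ≟ q | p ≟ r
  -- If the third edge had trivial gain in the joining frame, all three would lie on the triangle of
  -- that frame.
  ... | no p≢q | _ = let open Joining (joining p≢q α β) in
    e∈sub (plane⊆plane t t′ p≢q (λ s → noncol _ (on-tri first , on-tri second , on-tri s)) a b c a′ b′ c′ _ d)
  ... | _ | no p≢r = let open Joining (joining p≢r α γ) in
    e∈sub (plane⊆plane t t′ p≢r (λ s → noncol _ (on-tri first , on-tri s , on-tri second)) a c b a′ c′ b′ _ d)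
  -- Three edges of one class in a `sub` plane lie on a common coset.
  ... | yes refl | yes refl = contradiction (on-coset a , on-coset b , on-coset c) (noncol (coset p t g))

-- The matroid on the ground set E ∪ F.

module Lift (Γ : FinGroup) (D : Directions Γ) where
  open FinGroup Γ renaming (_∙_ to infixl 7 _∙_; _⁻¹ to infixl 8 _⁻¹)
  open Directions D
  open GroupSolver (group Γ) using (solve; _⊜_; _⊙_; _⁻; 𝟙)
  open GroupProperties (group Γ) using (⁻¹-involutive; x∙y⁻¹≈ε⇒x≈y)
  open Geometry Γ D
  module G = Geometry Γ D

  E# : ℕ
  E# = Edges Γ

  -- Labels of the class {1,3} are inverted, orienting the three classes as 1 → 2 → 3 → 1.
  orient : Fin 3 → Fin order → Fin order
  orient zero             α = α
  orient (suc zero)       α = α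
  orient (suc (suc zero)) α = α ⁻¹

  orient-involutive : ∀ p α → orient p (orient p α) ≡ α
  orient-involutive zero             α = refl
  orient-involutive (suc zero)       α = refl
  orient-involutive (suc (suc zero)) α = ⁻¹-involutive α

  -- A `Label` carries the group element of the graph edge, a `Point` the reoriented one; `index`
  -- leads to the ground set and `point` to the geometry.
  Label : Set
  Label = (Fin 3 × Fin order) ⊎ Fin 2

  index : Label → Fin (E# + 2)
  index = join E# 2 ∘ Sum.map₁ (uncurry (edge Γ))

  label : Fin (E# + 2) → Label
  label = Sum.map₁ (remQuot order) ∘ splitAt E#

  index-label : ∀ i → index (label i) ≡ i
  index-label i = trans (lemma (splitAt E# i)) (join-splitAt E# 2 i)
    where
    lemma : ∀ s → index (Sum.map₁ (remQuot order) s) ≡ join E# 2 s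
    lemma (inj₁ j) = cong (_↑ˡ 2) (combine-remQuot order j)
    lemma (inj₂ k) = refl

  label-index : ∀ l → label (index l) ≡ l
  label-index (inj₁ (p , α)) = trans
    (cong (Sum.map₁ (remQuot order)) (splitAt-↑ˡ E# (edge Γ p α) 2))
    (cong inj₁ (remQuot-combine p α))
  label-index (inj₂ k) = cong (Sum.map₁ (remQuot order)) (splitAt-↑ʳ E# 2 k)

  index-injective : ∀ {l l′} → index l ≡ index l′ → l ≡ l′
  index-injective eq = trans (sym (label-index _)) (trans (cong label eq) (label-index _))

  point : Label → Point
  point (inj₁ (p , α)) = e p (orient p α)
  point (inj₂ k)       = f k

  unpoint : Point → Label
  unpoint (e p α) = inj₁ (p , orient p α)
  unpoint (f k)   = inj₂ k

  unpoint-point : ∀ l → unpoint (point l) ≡ l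
  unpoint-point (inj₁ (p , α)) = cong (λ α → inj₁ (p , α)) (orient-involutive p α)
  unpoint-point (inj₂ k)       = refl

  decode : Fin (E# + 2) → Point
  decode = point ∘ label

  decode-injective : ∀ {i j} → decode i ≡ decode j → i ≡ j
  decode-injective {i} {j} eq = trans (sym (index-label i)) (trans (cong index
    (trans (sym (unpoint-point (label i))) (trans (cong unpoint eq) (unpoint-point (label j))))) (index-label j))

  line? : ∀ ℓ → Decidable (λ i → decode i ∈ˡ ℓ)
  line? ℓ i = decode i ∈ˡ? ℓ

  plane? : ∀ π → Decidable (λ i → decode i ∈ᵖ π)
  plane? π i = decode i ∈ᵖ? π

  space : PlanarSpace (E# + 2)
  space = record
    { Line          = Line
    ; Plane         = Plane
    ; line          = λ ℓ → comprehension (line? ℓ)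
    ; plane         = λ π → comprehension (plane? π)
    ; line-through  = λ a≢b → let ℓ , a∈ , b∈ = G.line-through _ _ (a≢b ∘ decode-injective)
                              in ℓ , ∈-comprehension⁺ (line? ℓ) a∈ , ∈-comprehension⁺ (line? ℓ) b∈
    ; line-unique   = λ ℓ ℓ′ a≢b a b a′ b′ c → ∈-comprehension⁺ (line? ℓ′)
                        (G.line-unique ℓ ℓ′ (a≢b ∘ decode-injective) (on ℓ a) (on ℓ b) (on ℓ′ a′) (on ℓ′ b′) (on ℓ c))
    ; plane-through = λ ℓ c → let π , ℓ⊆π , c∈π = G.plane-through ℓ (decode c)
                              in π , (λ x → ∈-comprehension⁺ (plane? π) (ℓ⊆π (on ℓ x))) , ∈-comprehension⁺ (plane? π) c∈π
    ; line⊆plane    = λ ℓ π a≢b a b a′ b′ c → ∈-comprehension⁺ (plane? π)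
                        (G.line⊆plane ℓ π (a≢b ∘ decode-injective) (on ℓ a) (on ℓ b) (inn π a′) (inn π b′) (on ℓ c))
    ; plane-unique  = λ π π′ noncollinear a b c a′ b′ c′ d → ∈-comprehension⁺ (plane? π′)
                        (G.plane-unique π π′
                          (λ ℓ (a , b , c) → noncollinear ℓ (on⁺ ℓ a , on⁺ ℓ b , on⁺ ℓ c))
                          (inn π a) (inn π b) (inn π c) (inn π′ a′) (inn π′ b′) (inn π′ c′) (inn π d))
    }
    where
    on : ∀ ℓ {i} → i ∈ comprehension (line? ℓ) → decode i ∈ˡ ℓ
    on ℓ = ∈-comprehension⁻ (line? ℓ)
    on⁺ : ∀ ℓ {i} → decode i ∈ˡ ℓ → i ∈ comprehension (line? ℓ)
    on⁺ ℓ = ∈-comprehension⁺ (line? ℓ)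
    inn : ∀ π {i} → i ∈ comprehension (plane? π) → decode i ∈ᵖ π
    inn π = ∈-comprehension⁻ (plane? π)

  open PlanarSpace space using (line; plane)
  open PlanarMatroid space

  ∈line⁺ : ∀ l {ℓ} → point l ∈ˡ ℓ → index l ∈ line ℓ
  ∈line⁺ l {ℓ} = ∈-comprehension⁺ (line? ℓ) ∘ subst (_∈ˡ ℓ) (cong point (sym (label-index l)))

  ∈line⁻ : ∀ l {ℓ} → index l ∈ line ℓ → point l ∈ˡ ℓ
  ∈line⁻ l {ℓ} = subst (_∈ˡ ℓ) (cong point (label-index l)) ∘ ∈-comprehension⁻ (line? ℓ)

  ∈plane⁺ : ∀ l {π} → point l ∈ᵖ π → index l ∈ plane π
  ∈plane⁺ l {π} = ∈-comprehension⁺ (plane? π) ∘ subst (_∈ᵖ π) (cong point (sym (label-index l)))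

  ∈plane⁻ : ∀ l {π} → index l ∈ plane π → point l ∈ᵖ π
  ∈plane⁻ l {π} = subst (_∈ᵖ π) (cong point (label-index l)) ∘ ∈-comprehension⁻ (plane? π)

  e∉class : ∀ {p q α} → p ≢ q → ¬ (e p α ∈ᵖ class q)
  e∉class p≢q e∈class = p≢q refl

  index-unique : ∀ {ls} → Unique ls → Unique (map index ls)
  index-unique = map⁺ index-injective

  edge-unique : ∀ {ls} → Unique ls → Unique (map (uncurry (edge Γ)) ls)
  edge-unique = map⁺ λ { {p , α} {q , β} eq → let p≡q , α≡β = combine-injective p α q β eq in cong₂ _,_ p≡q α≡β }

  K : Matroid (E# + 2)
  K = matroid

  L : Matroid E#
  L = restriction 2 K

  F : Subset (E# + 2)
  F = Fset E# 2

  F-independent : Independent F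
  F-independent = ∣X∣≤2⇒independent (≤-reflexive (∣Fset∣ E# 2))

  -- Contracting F gives the cycle matroid.

  at-most-one : ∀ {X} → CycleIndep Γ X → ∀ p → ∃[ α ] (∀ {γ} → edge Γ p γ ∈ X → γ ≡ α)
  at-most-one {X} acyclic p with any? (λ α → edge Γ p α ∈? X)
  -- A default value for a class without edges in `X`.
  ... | no none = ε , λ γ∈X → contradiction (_ , γ∈X) none
  ... | yes (α , α∈X) = α , λ {γ} γ∈X → unique γ∈X (γ ≟ α)
    where
    unique : ∀ {γ} → edge Γ p γ ∈ X → Dec (γ ≡ α) → γ ≡ α
    unique _ (yes γ≡α) = γ≡α
    unique {γ} γ∈X (no γ≢α) = ⊥-elim (acyclic
      (digon p α γ (γ≢α ∘ sym) , ∪-least (⁅x⁆⊆p α∈X) (⁅x⁆⊆p γ∈X)))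

  missing-class : ∀ {X} → CycleIndep Γ X → ∃[ r ] (∀ {γ} → edge Γ r γ ∉ X)
  missing-class {X} acyclic
    with any? (λ α → edge Γ zero α ∈? X)
       | any? (λ α → edge Γ (suc zero) α ∈? X)
       | any? (λ α → edge Γ (suc (suc zero)) α ∈? X)
  ... | no none | _ | _ = zero , λ γ∈ → none (_ , γ∈)
  ... | _ | no none | _ = suc zero , λ γ∈ → none (_ , γ∈)
  ... | _ | _ | no none = suc (suc zero) , λ γ∈ → none (_ , γ∈)
  ... | yes (α , α∈X) | yes (β , β∈X) | yes (γ , γ∈X) =
    ⊥-elim (acyclic (triangle α β γ , ∪-least (∪-least (⁅x⁆⊆p α∈X) (⁅x⁆⊆p β∈X)) (⁅x⁆⊆p γ∈X)))

  -- A forest misses a class and has at most one edge in each other class. Enlarging it to exactly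
  -- two edges leaves a single shape to be checked.
  forest-cover : ∀ {X} → CycleIndep Γ X →
    ∃[ p ] ∃[ q ] ∃[ α ] ∃[ β ] (p ≢ q × X ⊆ fromList (edge Γ p α ∷ edge Γ q β ∷ []))
  forest-cover {X} acyclic =
    let r , r∉X = missing-class acyclic
        α , α! = at-most-one acyclic (next r)
        β , β! = at-most-one acyclic (next (next r))
    in next r , next (next r) , α , β , next≢ (next r) ∘ sym ,
       λ {i} i∈X → cover r r∉X α! β! (remQuot order i) (combine-remQuot order i) i∈X
    where
    cover : ∀ r {α β} → (∀ {γ} → edge Γ r γ ∉ X) → (∀ {γ} → edge Γ (next r) γ ∈ X → γ ≡ α) →
            (∀ {γ} → edge Γ (next (next r)) γ ∈ X → γ ≡ β) →
            ∀ {i} ((p , γ) : Fin 3 × Fin order) → edge Γ p γ ≡ i → i ∈ X →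
            i ∈ fromList (edge Γ (next r) α ∷ edge Γ (next (next r)) β ∷ [])
    cover r {α} {β} r∉X α! β! (p , γ) refl = rotate
      (λ s → edge Γ s γ ∈ X → edge Γ s γ ∈ fromList (edge Γ (next r) α ∷ edge Γ (next (next r)) β ∷ [])) r
      (λ i∈X → contradiction i∈X r∉X)
      (λ i∈X → x∈p∪q⁺ (inj₂ (subst (λ δ → edge Γ (next r) γ ∈ ⁅ edge Γ (next r) δ ⁆) (α! i∈X) (x∈⁅x⁆ _))))
      (λ i∈X → x∈p∪q⁺ (inj₁ (x∈p∪q⁺ (inj₂ (subst (λ δ → edge Γ (next (next r)) γ ∈ ⁅ edge Γ (next (next r)) δ ⁆) (β! i∈X) (x∈⁅x⁆ _))))))
      p

  -- Start from `F` on the line `ff`, add `b` off this line, then add `a`, which is off the plane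
  -- `class q` spanned so far.
  forest+F-independent : ∀ {X} → CycleIndep Γ X → Independent (embedE X ∪ F)
  forest+F-independent {X} acyclic with forest-cover acyclic
  ... | p , q , α , β , p≢q , X⊆ = independent-⊆
    (∪-least
      (λ i∈X → All-∈⇒⊆ ab∈ (embedE-fromList 2 (edge Γ p α ∷ edge Γ q β ∷ []) (embedE-mono 2 X⊆ i∈X)))
      (λ i∈F → p⊆p∪q _ (p⊆p∪q _ i∈F)))
    (extend-plane (class q)
      (extend-line ff (∣Fset∣ E# 2) (F⊆ λ k → ∈line⁺ (inj₂ k) on-ff) b∉ff)
      (trans (∣p∪⁅x⁆∣ F b∉F) (cong suc (∣Fset∣ E# 2)))
      (∪-least (F⊆ λ k → ∈plane⁺ (inj₂ k) f∈class) (⁅x⁆⊆p (∈plane⁺ (inj₁ (q , β)) e∈class)))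
      (e∉class p≢q ∘ ∈plane⁻ (inj₁ (p , α))))
    where
    a = index (inj₁ (p , α))
    b = index (inj₁ (q , β))
    ab∈ : All (_∈ (F ∪ ⁅ b ⁆) ∪ ⁅ a ⁆) (a ∷ b ∷ [])
    ab∈ = q⊆p∪q (F ∪ ⁅ b ⁆) _ (x∈⁅x⁆ a) ∷ p⊆p∪q _ (q⊆p∪q F _ (x∈⁅x⁆ b)) ∷ []
    F⊆ : ∀ {Z} → (∀ k → E# ↑ʳ k ∈ Z) → F ⊆ Z
    F⊆ {Z} all i∈F = let k , eq = ∈-Fset⁻ E# i∈F in subst (_∈ Z) (sym eq) (all k)
    b∉F : b ∉ F
    b∉F b∈F with ∈-Fset⁻ E# b∈F
    ... | k , eq with () ← index-injective {inj₁ (q , β)} {inj₂ k} eq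
    b∉ff : b ∉ line ff
    b∉ff b∈ff with () ← ∈line⁻ (inj₁ (q , β)) b∈ff

  -- A digon together with the two points of `F` puts four points into a class plane; a triangle
  -- together with them gives five points.
  contraction-acyclic : ∀ {X B} → F ⊆ B → Independent (embedE X ∪ B) → CycleIndep Γ X
  contraction-acyclic {X} {B} F⊆B ind (c , c⊆X) = acyclic c c⊆X
    where
    old : ∀ {i} → i ∈ X → i ↑ˡ 2 ∈ embedE X ∪ B
    old i∈X = p⊆p∪q B (∈-embedE⁺ 2 i∈X)
    new : ∀ k → E# ↑ʳ k ∈ embedE X ∪ B
    new k = q⊆p∪q (embedE X) B (F⊆B (∈-Fset⁺ E# k))
    acyclic : ∀ c → ¬ (cycleEdges Γ c ⊆ X)
    acyclic (digon p α β α≢β) c⊆X = 1+n≰n (≤-trans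
      (length≤∣p∣
        (index-unique {inj₁ (p , α) ∷ inj₁ (p , β) ∷ inj₂ zero ∷ inj₂ (suc zero) ∷ []}
          (((λ { refl → α≢β refl }) ∷ (λ ()) ∷ (λ ()) ∷ []) ∷ ((λ ()) ∷ (λ ()) ∷ []) ∷ ((λ ()) ∷ []) ∷ [] ∷ []))
        ( x∈p∩q⁺ (old (c⊆X (p⊆p∪q _ (x∈⁅x⁆ _))) , ∈plane⁺ (inj₁ (p , α)) e∈class)
        ∷ x∈p∩q⁺ (old (c⊆X (q⊆p∪q ⁅ edge Γ p α ⁆ _ (x∈⁅x⁆ _))) , ∈plane⁺ (inj₁ (p , β)) e∈class)
        ∷ x∈p∩q⁺ (new zero , ∈plane⁺ (inj₂ zero) f∈class)
        ∷ x∈p∩q⁺ (new (suc zero) , ∈plane⁺ (inj₂ (suc zero)) f∈class) ∷ []))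
      (∣X∩plane∣≤3 ind (class p)))
    acyclic (triangle α β γ) c⊆X = 1+n≰n (≤-trans
      (length≤∣p∣
        (index-unique {inj₁ (zero , α) ∷ inj₁ (suc zero , β) ∷ inj₁ (suc (suc zero) , γ) ∷ inj₂ zero ∷ inj₂ (suc zero) ∷ []}
          (((λ ()) ∷ (λ ()) ∷ (λ ()) ∷ (λ ()) ∷ []) ∷ ((λ ()) ∷ (λ ()) ∷ (λ ()) ∷ []) ∷ ((λ ()) ∷ (λ ()) ∷ []) ∷ ((λ ()) ∷ []) ∷ [] ∷ []))
        ( old (c⊆X (p⊆p∪q _ (p⊆p∪q _ (x∈⁅x⁆ _))))
        ∷ old (c⊆X (p⊆p∪q _ (q⊆p∪q ⁅ edge Γ zero α ⁆ _ (x∈⁅x⁆ _))))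
        ∷ old (c⊆X (q⊆p∪q (⁅ edge Γ zero α ⁆ ∪ ⁅ edge Γ (suc zero) β ⁆) _ (x∈⁅x⁆ _)))
        ∷ new zero ∷ new (suc zero) ∷ []))
      (∣X∣≤4 ind))

  contraction : ∀ X → CycleIndep Γ X ⇔ ContractIndep {E#} {2} K X
  contraction X = mk⇔ contract (λ (B , B⊆F , _ , maximal , ind) → contraction-acyclic (F⊆B B⊆F maximal) ind)
    where
    contract : CycleIndep Γ X → ContractIndep {E#} {2} K X
    contract acyclic = F , ⊆-refl , F-independent , (λ _ y∈F y∉F → contradiction y∈F y∉F) , forest+F-independent acyclic
    -- Since `F` is itself independent, a maximal independent subset of it is all of `F`.
    F⊆B : ∀ {B} → B ⊆ F → (∀ y → y ∈ F → y ∉ B → ¬ Independent (B ∪ ⁅ y ⁆)) → F ⊆ B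
    F⊆B {B} B⊆F maximal {y} y∈F with y ∈? B
    ... | yes y∈B = y∈B
    ... | no  y∉B = contradiction
      (independent-⊆ (∪-least B⊆F (⁅x⁆⊆p y∈F)) F-independent)
      (maximal y y∈F y∉B)

  -- The ranks 2 and 4.

  cycle-rank : HasRank (CycleIndep Γ) 2
  cycle-rank = (fromList path , acyclic , ∣fromList∣ (edge-unique {(zero , ε) ∷ (suc zero , ε) ∷ []} (((λ ()) ∷ []) ∷ [] ∷ []))) ,
    λ X aX → let p , q , α , β , _ , X⊆ = forest-cover aX
             in ≤-trans (p⊆q⇒∣p∣≤∣q∣ X⊆) (∣fromList∣≤ (edge Γ p α ∷ edge Γ q β ∷ []))
    where
    path = edge Γ zero ε ∷ edge Γ (suc zero) ε ∷ []
    path⁻ : ∀ p α → edge Γ p α ∈ fromList path → p ≢ suc (suc zero) × α ≡ ε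
    path⁻ p α i∈ with x∈p∪q⁻ (fromList (edge Γ (suc zero) ε ∷ [])) ⁅ edge Γ zero ε ⁆ i∈
    ... | inj₂ i∈0 with combine-injective p α zero ε (x∈⁅y⁆⇒x≡y _ i∈0)
    ... | refl , α≡ε = (λ ()) , α≡ε
    path⁻ p α i∈ | inj₁ i∈1 with x∈p∪q⁻ ∅ ⁅ edge Γ (suc zero) ε ⁆ i∈1
    ... | inj₁ i∈∅ = contradiction i∈∅ ∉⊥
    ... | inj₂ i∈1′ with combine-injective p α (suc zero) ε (x∈⁅y⁆⇒x≡y _ i∈1′)
    ... | refl , α≡ε = (λ ()) , α≡ε
    acyclic : CycleIndep Γ (fromList path)
    acyclic (digon p α β α≢β , c⊆) = α≢β (trans
      (proj₂ (path⁻ p α (c⊆ (p⊆p∪q _ (x∈⁅x⁆ _)))))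
      (sym (proj₂ (path⁻ p β (c⊆ (q⊆p∪q ⁅ edge Γ p α ⁆ _ (x∈⁅x⁆ _)))))))
    acyclic (triangle α β γ , c⊆) =
      proj₁ (path⁻ _ γ (c⊆ (q⊆p∪q (⁅ edge Γ zero α ⁆ ∪ ⁅ edge Γ (suc zero) β ⁆) _ (x∈⁅x⁆ _)))) refl

  lift-rank : HasRank (Indep L) 4
  lift-rank = (fromList basis , independent-⊆ (embedE-fromList 2 basis) basis-independent , ∣fromList∣ (edge-unique pairs-unique)) ,
    λ X iX → ≤-trans (≤-reflexive (sym (∣embedE∣ 2 X))) (∣X∣≤4 iX)
    where
    -- Built up from the end of the list: `ε` and `g₁` lie on the coset `ℓ`, `g₂` is off `ℓ` but in
    -- the same class, and the edge of class {2,3} is off that class plane.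
    pairs : List (Fin 3 × Fin order)
    pairs = (suc zero , ε) ∷ (zero , g₂) ∷ (zero , g₁) ∷ (zero , ε) ∷ []

    basis : List (Fin E#)
    basis = map (uncurry (edge Γ)) pairs

    pairs-unique : Unique pairs
    pairs-unique = ((λ ()) ∷ (λ ()) ∷ (λ ()) ∷ [])
      ∷ ((λ eq → g₂∉⟨g₁⟩ (subst (Span g₁ ∘ proj₂) (sym eq) span-refl)) ∷ (λ eq → g₂∉⟨g₁⟩ (subst (Span g₁ ∘ proj₂) (sym eq) span-ε)) ∷ [])
      ∷ ((g₁≢ε ∘ cong proj₂) ∷ []) ∷ [] ∷ []

    embedded-unique : Unique (map (_↑ˡ 2) basis)
    embedded-unique = map⁺ (↑ˡ-injective 2 _ _) (edge-unique pairs-unique)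

    1-frame : Frame
    1-frame _ = ε

    gain-1-frame : ∀ α → gain 1-frame zero α ≡ α
    gain-1-frame = solve 1 (λ α → 𝟙 ⁻ ⊙ α ⊙ 𝟙 ⊜ α) refl

    ℓ : Line
    ℓ = coset zero 1-frame g₁

    off-ℓ : ¬ (e zero g₂ ∈ˡ ℓ)
    off-ℓ (on-coset s) = g₂∉⟨g₁⟩ (subst (Span g₁) (gain-1-frame g₂) s)

    on-ℓ : ∀ α → Span g₁ α → index (inj₁ (zero , α)) ∈ line ℓ
    on-ℓ α s = ∈line⁺ (inj₁ (zero , α)) (on-coset (subst (Span g₁) (sym (gain-1-frame α)) s))

    in-class : ∀ α → index (inj₁ (zero , α)) ∈ plane (class zero)
    in-class α = ∈plane⁺ (inj₁ (zero , α)) e∈class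

    basis-independent : Independent (fromList (map (_↑ˡ 2) basis))
    basis-independent = extend-plane (class zero)
      (extend-line ℓ (∣fromList∣ (AllPairs.tail (AllPairs.tail embedded-unique)))
        (All-∈⇒⊆ (on-ℓ g₁ span-refl ∷ on-ℓ ε span-ε ∷ []))
        (off-ℓ ∘ ∈line⁻ (inj₁ (zero , g₂))))
      (∣fromList∣ (AllPairs.tail embedded-unique))
      (All-∈⇒⊆ (in-class g₂ ∷ in-class g₁ ∷ in-class ε ∷ []))
      (e∉class (λ ()) ∘ ∈plane⁻ (inj₁ (suc zero , ε)))

  -- Circuits and balanced cycles.

  ∣X∣≤2⇒L-independent : ∀ {X} → ∣ X ∣ ≤ 2 → Indep L X
  ∣X∣≤2⇒L-independent {X} ≤2 = ∣X∣≤2⇒independent (≤-trans (≤-reflexive (∣embedE∣ 2 X)) ≤2)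

  ∣pair∣≤2 : ∀ (a b : Fin E#) → ∣ ⁅ a ⁆ ∪ ⁅ b ⁆ ∣ ≤ 2
  ∣pair∣≤2 a b = ≤-trans (∣p∪⁅x⁆∣≤ ⁅ a ⁆ b) (s≤s (≤-reflexive (∣⁅x⁆∣≡1 a)))

  module Triangle (α β γ : Fin order) where
    a b c : Fin E#
    a = edge Γ zero α
    b = edge Γ (suc zero) β
    c = edge Γ (suc (suc zero)) γ

    C = (⁅ a ⁆ ∪ ⁅ b ⁆) ∪ ⁅ c ⁆

    open Joining (joining-next zero α β)

    -- In the joining frame of `a` and `b`, the gain of `c` is a conjugate of the product around the
    -- triangle. Hence balance means that `c` lies on the line through `a` and `b`.
    gain-c : gain frame (suc (suc zero)) (γ ⁻¹) ≡ α ⁻¹ ∙ (α ∙ β ∙ γ ⁻¹) ∙ α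
    gain-c = solve 3 (λ α β γ → β ⁻ ⁻ ⊙ γ ⁻ ⊙ α ⊜ α ⁻ ⊙ (α ⊙ β ⊙ γ ⁻) ⊙ α) refl α β γ

    a∈ : a ↑ˡ 2 ∈ line (tri frame)
    a∈ = ∈line⁺ (inj₁ (zero , α)) (on-tri first)

    b∈ : b ↑ˡ 2 ∈ line (tri frame)
    b∈ = ∈line⁺ (inj₁ (suc zero , β)) (on-tri second)

    balanced⇒c∈ : Balanced Γ (triangle α β γ) → c ↑ˡ 2 ∈ line (tri frame)
    balanced⇒c∈ balanced = ∈line⁺ (inj₁ (suc (suc zero) , γ)) (on-tri (≡ε⇒span (trans gain-c
      (trans (cong (λ x → α ⁻¹ ∙ x ∙ α) balanced) (solve 1 (λ α → α ⁻ ⊙ 𝟙 ⊙ α ⊜ 𝟙) refl α)))))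

    c∈⇒balanced : c ↑ˡ 2 ∈ line (tri frame) → Balanced Γ (triangle α β γ)
    c∈⇒balanced c∈ with ∈line⁻ (inj₁ (suc (suc zero) , γ)) c∈
    ... | on-tri s = trans (solve 2 (λ α x → x ⊜ α ⊙ (α ⁻ ⊙ x ⊙ α) ⊙ α ⁻) refl α (α ∙ β ∙ γ ⁻¹))
      (trans (cong (λ x → α ∙ x ∙ α ⁻¹) (trans (sym gain-c) (span-ε⁻ s)))
             (solve 1 (λ α → α ⊙ 𝟙 ⊙ α ⁻ ⊜ 𝟙) refl α))

    balanced⇒circuit : Balanced Γ (triangle α β γ) → IsCircuit L C
    -- The three edges are collinear, while a proper subset has at most two elements.
    balanced⇒circuit balanced = dependent , λ Y Y⊂C → ∣X∣≤2⇒L-independent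
      (s≤s⁻¹ (≤-trans (p⊂q⇒∣p∣<∣q∣ Y⊂C) (≤-trans (∣p∪⁅x⁆∣≤ (⁅ a ⁆ ∪ ⁅ b ⁆) c) (s≤s (∣pair∣≤2 a b)))))
      where
      dependent : ¬ Indep L C
      dependent ind = 1+n≰n (≤-trans
        (length≤∣p∣
          (index-unique {inj₁ (zero , α) ∷ inj₁ (suc zero , β) ∷ inj₁ (suc (suc zero) , γ) ∷ []}
            (((λ ()) ∷ (λ ()) ∷ []) ∷ ((λ ()) ∷ []) ∷ [] ∷ []))
          ( x∈p∩q⁺ (∈-embedE⁺ 2 (p⊆p∪q _ (p⊆p∪q _ (x∈⁅x⁆ a))) , a∈)
          ∷ x∈p∩q⁺ (∈-embedE⁺ 2 (p⊆p∪q _ (q⊆p∪q ⁅ a ⁆ _ (x∈⁅x⁆ b))) , b∈)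
          ∷ x∈p∩q⁺ (∈-embedE⁺ 2 (q⊆p∪q (⁅ a ⁆ ∪ ⁅ b ⁆) _ (x∈⁅x⁆ c)) , balanced⇒c∈ balanced)
          ∷ []))
        (∣X∩line∣≤2 ind (tri frame)))

    -- In an unbalanced triangle `c` is off the line through `a` and `b`, so the three edges are
    -- independent.
    circuit⇒balanced : IsCircuit L C → Balanced Γ (triangle α β γ)
    circuit⇒balanced (dependent , _) with α ∙ β ∙ γ ⁻¹ ≟ ε
    ... | yes balanced = balanced
    ... | no unbalanced = contradiction
      (independent-⊆ (embedE-∪⁅⁆ 2 (⁅ a ⁆ ∪ ⁅ b ⁆) c)
        (extend-line (tri frame) size pair⊆ (unbalanced ∘ c∈⇒balanced))) dependent
      where
      b∉⁅a⁆ : b ∉ ⁅ a ⁆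
      b∉⁅a⁆ b∈ with () ← proj₁ (combine-injective {3} (suc zero) β zero α (x∈⁅y⁆⇒x≡y a b∈))
      size : ∣ embedE {f = 2} (⁅ a ⁆ ∪ ⁅ b ⁆) ∣ ≡ 2
      size = trans (∣embedE∣ 2 (⁅ a ⁆ ∪ ⁅ b ⁆))
        (trans (∣p∪⁅x⁆∣ ⁅ a ⁆ {b} b∉⁅a⁆) (cong suc (∣⁅x⁆∣≡1 a)))
      pair⊆ : embedE (⁅ a ⁆ ∪ ⁅ b ⁆) ⊆ line (tri frame)
      pair⊆ = ⊆-trans (embedE-∪⁅⁆ 2 ⁅ a ⁆ b) (∪-least (⊆-trans (embedE-⁅⁆ 2 a) (⁅x⁆⊆p a∈)) (⁅x⁆⊆p b∈))

  -- For a digon both sides are false: two elements are always independent, and distinct parallel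
  -- edges are never balanced.
  circuit⇔balanced : ∀ c → IsCircuit L (cycleEdges Γ c) ⇔ Balanced Γ c
  circuit⇔balanced (digon p α β α≢β) = mk⇔
    (λ (dependent , _) → contradiction (∣X∣≤2⇒L-independent (∣pair∣≤2 (edge Γ p α) (edge Γ p β))) dependent)
    (λ balanced → contradiction (x∙y⁻¹≈ε⇒x≈y α β balanced) α≢β)
  circuit⇔balanced (triangle α β γ) = mk⇔ circuit⇒balanced balanced⇒circuit
    where open Triangle α β γ

theorem4p3 : (Γ : FinGroup) → NontrivialPartition Γ →
    Σ (Matroid (Edges Γ)) λ M →
    IsRankLift 2 (CycleIndep Γ) M
    × ((c : Cycle Γ) → (IsCircuit M (cycleEdges Γ c) ⇔ Balanced Γ c))
theorem4p3 Γ partition =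
  L , ((2 , K , contraction , λ _ → mk⇔ id id) , 2 , cycle-rank , lift-rank) , circuit⇔balanced
  where open Lift Γ (directions Γ partition)
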